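{- There is no distance-regular graph with intersection array $\{32,27,9,1;1,3,27,32\}$.
   Context: A connected graph of diameter $d$ is distance-regular with intersection array $\{b_0,\ldots,b_{d-1};c_1,\ldots,c_d\}$ if for all $i$ and all vertices $v,w$ at distance $i$, $w$ has exactly $b_i$ neighbours at distance $i+1$ from $v$ and exactly $c_i$ neighbours at distance $i-1$ from $v$. -}

module Defs where

open import Data.Nat using (ℕ; zero; suc; _≤_; _<_)
open import Data.Fin using (Fin; toℕ)
open import Data.Vec using (Vec; lookup)
open import Data.List using (List; length)
open import Data.List.Membership.Propositional using (_∈_)
open import Data.List.Relation.Unary.Unique.Propositional using (Unique)
open import Data.Product using (Σ; ∃; ∃-syntax; _×_)
open import Data.Empty using (⊥)
open import Relation.Nullary using (¬_; Dec)
open import Relation.Binary.PropositionalEquality using (_≡_)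
open import Function.Bundles using (_⇔_)

record SimpleGraph (n : ℕ) : Set₁ where
  field
    Adj     : Fin n → Fin n → Set
    adj?    : ∀ v w → Dec (Adj v w)
    sym     : ∀ {v w} → Adj v w → Adj w v
    irrefl  : ∀ {v} → ¬ Adj v v

module _ {n : ℕ} (G : SimpleGraph n) where
  open SimpleGraph G

  data Walk : ℕ → Fin n → Fin n → Set where
    nil  : ∀ {v} → Walk zero v v
    cons : ∀ {k u v w} → Adj u v → Walk k v w → Walk (suc k) u w

  Dist : Fin n → Fin n → ℕ → Set
  Dist v w i = Walk i v w × (∀ j → j < i → ¬ Walk j v w)

  HasExactly : (Fin n → Set) → ℕ → Set
  HasExactly P k = Σ (List (Fin n)) λ L →
    length L ≡ k × Unique L × (∀ u → (u ∈ L) ⇔ P u)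

  ConnectedWithDiameter : ℕ → Set
  ConnectedWithDiameter d =
    (∀ v w → ∃[ i ] Dist v w i) ×
    (∀ v w i → Dist v w i → i ≤ d) ×
    (∃[ v ] ∃[ w ] Dist v w d)

  -- Distance-regular with intersection array {b₀,…,b_{d-1}; c₁,…,c_d}.
  -- b is indexed b₀..b_{d-1}; c is indexed so that lookup c i = c_{i+1}.
  IsDistanceRegular : (d : ℕ) → Vec ℕ d → Vec ℕ d → Set
  IsDistanceRegular d b c =
    ConnectedWithDiameter d ×
    (∀ (i : Fin d) v w → Dist v w (toℕ i) →
       HasExactly (λ u → Adj w u × Dist v u (suc (toℕ i))) (lookup b i)) ×
    (∀ (i : Fin d) v w → Dist v w (suc (toℕ i)) →
       HasExactly (λ u → Adj w u × Dist v u (toℕ i)) (lookup c i))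

{-# OPTIONS --safe #-}
module Submission where

-- The eigenvalue -10 has multiplicity 20, less than the valency 32, so the
-- Gram matrix E of its eigenspace constrains the local graph L at a vertex v.
-- Positivity of E excludes local cycles of length 3, 4 and 5.  Approximating
-- the projection of every vertex onto the span of the neighbours of v gives a
-- lower bound for the number of closed 6-walks in L; positivity of E on L gives
-- the same upper bound.  Equality forces L (L + 2) (L + 4) (L - 2) = 12 J and
-- expresses every vertex through neighbours of v modulo the kernel of E.  Thus
-- L is bipartite with eigenvalue -4, and by the Gram matrix Γ of the eigenvalue
-- 8 its ±1 bipartition vector is orthogonal to the row Γ u of every vertex u.
-- Take u at distance 2 from v such that the three common neighbours of u and v
-- contain an edge, and let m be the indicator function of the neighbours of v
-- at distance 1 or 3 from u.  The relations combine to 3 ⟨ m , L m ⟩ = 16.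

-- The target is the spectrum 4, 2, 0, -2, -4 of `L` with multiplicities 1, 12, 6, 12, 1. It has the
-- closed walks of a 4-regular graph on 32 vertices without cycles of length 3, 4 and 5, and on
-- average 304 closed 6-walks at a vertex; this is the origin of 304. No eigenvalue of `L` is
-- computed: each spectral statement becomes a polynomial identity in `L` over ℤ. Positivity says
-- that `L` is at most 2 off the constants, and rank 20 asks for a frequent eigenvalue 2. The others
-- should be -4 and the further roots of q(t) = t (t + 2) (t + 4). At these roots γ(t) is 48 / (2 -
-- t), so off the constants γ(L) inverts the local Gram matrix 7 (2 - L) up to the factor 336. It
-- yields the exact projection under the target spectrum, and a usable trial vector before that is
-- known; hence both bounds meet at 304. The choice of u is essential: if the three common
-- neighbours lay in one half of the bipartition, the same relations would give ⟨ m , L m ⟩ = 0 and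
-- no contradiction. An edge among them splits them 2 : 1.

open import Defs
open import Algebra.Bundles using (CommutativeRing)
import Algebra.Properties.Semiring.Sum
import Algebra.Solver.Ring
open import Algebra.Solver.Ring.AlmostCommutativeRing
  using (fromCommutativeRing; _-Raw-AlmostCommutative⟶_)
import Algebra.Structures
open import Data.Bool using (if_then_else_)
open import Data.Empty using (⊥; ⊥-elim)
open import Data.Fin using (Fin; zero; suc)
open import Data.Fin.Properties using (_≟_)
open import Data.Integer using (ℤ; +_; -[1+_]; _≤_; +≤+)
import Data.Integer as ℤ
import Data.Integer.Properties as ℤₚ
open import Data.List using (List; []; _∷_; length)
import Data.List.Membership.DecPropositional
open import Data.List.Membership.Propositional using (_∈_)
open import Data.List.Relation.Unary.All as All using (All; []; _∷_)
open import Data.List.Relation.Unary.AllPairs using (_∷_; [])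
open import Data.List.Relation.Unary.Any using (here; there)
open import Data.List.Relation.Unary.Unique.Propositional using (Unique)
open import Data.Maybe using (Maybe)
open import Data.Nat using (ℕ; zero; suc; pred; z≤n; s≤s)
import Data.Nat as ℕ
open import Data.Nat.Divisibility using (divides; _∣?_)
import Data.Nat.Properties as ℕₚ
open import Data.Product using (_×_; _,_; ∃; proj₁; proj₂)
open import Data.Sum using (_⊎_; inj₁; inj₂)
open import Data.Vec using (_∷_; [])
open import Function.Bundles using (Equivalence)
open import Level using (0ℓ)
open import Relation.Binary.Definitions using (tri<; tri≈; tri>)
open import Relation.Binary.PropositionalEquality
open import Relation.Nullary using (Dec; yes; no; does; ¬_)
open import Relation.Nullary.Decidable using (from-no)
open import Relation.Nullary.Decidable.Core using (dec⇒maybe)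

-- Integer arithmetic and finite sums

open Algebra.Structures {A = ℤ} _≡_ using (IsCommutativeRing)

infixl 6 _+_ _-_
infixl 7 _*_
infix 8 -_

-- Opaque, because otherwise conversion checking unrolls products with large
-- literals in unary.
opaque
  _+_ _*_ : ℤ → ℤ → ℤ
  _+_ = ℤ._+_
  _*_ = ℤ._*_

  -_ : ℤ → ℤ
  -_ = ℤ.-_

_-_ : ℤ → ℤ → ℤ
x - y = x + - y

opaque
  unfolding _+_

  +-*-isCommutativeRing : IsCommutativeRing _+_ _*_ -_ (+ 0) (+ 1)
  +-*-isCommutativeRing = ℤₚ.+-*-isCommutativeRing

  +-homo : ∀ x y → x ℤ.+ y ≡ x + y
  +-homo x y = refl

  *-homo : ∀ x y → x ℤ.* y ≡ x * y
  *-homo x y = refl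

  neg-homo : ∀ x → ℤ.- x ≡ - x
  neg-homo x = refl

  +-nonneg : ∀ {x y} → + 0 ≤ x → + 0 ≤ y → + 0 ≤ x + y
  +-nonneg = ℤₚ.+-mono-≤

  *-nonneg : ∀ {x y} → + 0 ≤ x → + 0 ≤ y → + 0 ≤ x * y
  *-nonneg {+ m} {+ n} _ _ = subst (+ 0 ≤_) (ℤₚ.pos-* m n) (+≤+ ℕ.z≤n)

  square-nonneg : ∀ x → + 0 ≤ x * x
  square-nonneg (+ n) = *-nonneg {+ n} {+ n} (+≤+ ℕ.z≤n) (+≤+ ℕ.z≤n)
  square-nonneg -[1+ n ] = +≤+ ℕ.z≤n

  *-zero : ∀ {x y} → x * y ≡ + 0 → x ≡ + 0 ⊎ y ≡ + 0
  *-zero {x} = ℤₚ.i*j≡0⇒i≡0∨j≡0 x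

  *-cancelˡ : ∀ k {x y} → + suc k * x ≡ + suc k * y → x ≡ y
  *-cancelˡ k {x} {y} = ℤₚ.*-cancelˡ-≡ (+ suc k) x y

  *-nonneg-cancelˡ : ∀ k {x} → + 0 ≤ + suc k * x → + 0 ≤ x
  *-nonneg-cancelˡ k {x} p = ℤₚ.*-cancelˡ-≤-pos (+ 0) x (+ suc k)
    (subst (_≤ + suc k * x) (sym (ℤₚ.*-zeroʳ (+ suc k))) p)

  ≤⇒0≤- : ∀ {x y} → x ≤ y → + 0 ≤ y - x
  ≤⇒0≤- = ℤₚ.i≤j⇒0≤j-i

  0≤-⇒≤ : ∀ {x y} → + 0 ≤ y - x → x ≤ y
  0≤-⇒≤ = ℤₚ.0≤i-j⇒j≤i

  -- False over the reals: this is where the bound on short cycles uses integrality.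
  ≤-square : ∀ {x} → + 0 ≤ x → x ≤ x * x
  ≤-square {+ zero} _ = +≤+ ℕ.z≤n
  ≤-square {+ suc n} _ = subst (_≤ + suc n * + suc n) (ℤₚ.*-identityʳ (+ suc n))
    (ℤₚ.*-monoˡ-≤-nonNeg (+ suc n) (+≤+ (ℕ.s≤s ℕ.z≤n)))

square-zero : ∀ {x} → x * x ≡ + 0 → x ≡ + 0
square-zero p with *-zero p
... | inj₁ q = q
... | inj₂ q = q

ℤ-ring : CommutativeRing 0ℓ 0ℓ
ℤ-ring = record { isCommutativeRing = +-*-isCommutativeRing }

coefficients : CommutativeRing.rawRing ℤₚ.+-*-commutativeRing -Raw-AlmostCommutative⟶
    fromCommutativeRing ℤ-ring
coefficients = record
  { ⟦_⟧ = λ x → x ; +-homo = +-homo ; *-homo = *-homo ; -‿homo = neg-homo ; 0-homo = refl ; 1-homo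
      = refl }

coefficient-≟ : ∀ (x y : ℤ) → Maybe (x ≡ y)
coefficient-≟ x y = dec⇒maybe (x ℤₚ.≟ y)

open Algebra.Solver.Ring (CommutativeRing.rawRing ℤₚ.+-*-commutativeRing)
    (fromCommutativeRing ℤ-ring)
  coefficients coefficient-≟ using (Polynomial; con; solve; _:+_; _:*_; _:-_; :-_; _:=_)

κ : ∀ {m} → ℕ → Polynomial m
κ k = con (+ k)

open CommutativeRing ℤ-ring
  using (*-comm; *-assoc; zeroˡ; zeroʳ; +-identityˡ; +-identityʳ; *-identityˡ)
open Algebra.Properties.Semiring.Sum (CommutativeRing.semiring ℤ-ring)
  using (sum; sum-cong-≗; ∑-distrib-+; ∑-comm; *-distribˡ-sum; *-distribʳ-sum)

-≡0⇒≡ : ∀ {x y} → x - y ≡ + 0 → x ≡ y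
-≡0⇒≡ {x} {y} p = trans (solve 2 (λ x y → x := (x :- y) :+ y) refl x y)
    (trans (cong (_+ y) p) (+-identityˡ y))

≤-antisym-0 : ∀ {x} → + 0 ≤ x → + 0 ≤ - x → x ≡ + 0
≤-antisym-0 {x} p q = ℤₚ.≤-antisym (0≤-⇒≤ (subst (+ 0 ≤_) (sym (+-identityˡ (- x))) q)) p

+-zero-nonneg : ∀ {x y} → + 0 ≤ x → + 0 ≤ y → x + y ≡ + 0 → x ≡ + 0 × y ≡ + 0
+-zero-nonneg {x} {y} p q e =
    ≤-antisym-0 p (subst (+ 0 ≤_) (trans (solve 2 (λ x y → y := (x :+ y) :- x) refl x y)
        (trans (cong (_- x) e) (+-identityˡ (- x)))) q)
  , ≤-antisym-0 q (subst (+ 0 ≤_)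
      (trans (solve 2 (λ x y → x := (x :+ y) :- y) refl x y)
      (trans (cong (_- y) e) (+-identityˡ (- y)))) p)

sum-nonneg : ∀ {n} {f : Fin n → ℤ} → (∀ i → + 0 ≤ f i) → + 0 ≤ sum f
sum-nonneg {zero} h = +≤+ ℕ.z≤n
sum-nonneg {suc n} h = +-nonneg (h zero) (sum-nonneg (λ i → h (suc i)))

sum-zero-nonneg : ∀ {n} {f : Fin n → ℤ} → (∀ i → + 0 ≤ f i) → sum f ≡ + 0 → ∀ i → f i ≡ + 0
sum-zero-nonneg {suc n} h e i with +-zero-nonneg (h zero) (sum-nonneg (λ i → h (suc i))) e
sum-zero-nonneg {suc n} h e zero | p , q = p
sum-zero-nonneg {suc n} h e (suc i) | p , q = sum-zero-nonneg (λ i → h (suc i)) q i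

sum-zero : ∀ {n} {f : Fin n → ℤ} → (∀ i → f i ≡ + 0) → sum f ≡ + 0
sum-zero {zero} h = refl
sum-zero {suc n} h = trans (cong₂ _+_ (h zero) (sum-zero (λ i → h (suc i)))) (+-identityˡ (+ 0))

-- Turns a count into a witness; midpoints of 2-walks, local edges and common neighbours are all
-- found in this way.
sum-nonzero : ∀ {n} {f : Fin n → ℤ} → ¬ sum f ≡ + 0 → ∃ λ i → ¬ f i ≡ + 0
sum-nonzero {zero} h = ⊥-elim (h refl)
sum-nonzero {suc n} {f} h with f zero ℤₚ.≟ + 0
... | no p = zero , p
... | yes p with sum-nonzero {n} {λ i → f (suc i)}
    (λ q → h (trans (cong₂ _+_ p q) (+-identityˡ (+ 0))))
...   | i , r = suc i , r

sum-linear₃ : ∀ {n} α β γ (f g h : Fin n → ℤ) →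
  sum (λ i → α * f i + β * g i + γ * h i) ≡ α * sum f + β * sum g + γ * sum h
sum-linear₃ α β γ f g h =
  trans (∑-distrib-+ (λ i → α * f i + β * g i) (λ i → γ * h i))
    (cong₂ _+_ (trans (∑-distrib-+ (λ i → α * f i) (λ i → β * g i))
        (cong₂ _+_ (sym (*-distribˡ-sum α f)) (sym (*-distribˡ-sum β g))))
        (sym (*-distribˡ-sum γ h)))

𝟙 : ∀ {P : Set} → Dec P → ℤ
𝟙 p = if does p then + 1 else + 0

𝟙-yes : ∀ {P : Set} (d : Dec P) → P → 𝟙 d ≡ + 1
𝟙-yes (yes _) p = refl
𝟙-yes (no ¬p) p = ⊥-elim (¬p p)

𝟙-no : ∀ {P : Set} (d : Dec P) → ¬ P → 𝟙 d ≡ + 0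
𝟙-no (yes p) ¬p = ⊥-elim (¬p p)
𝟙-no (no _) _ = refl

𝟙-cong : ∀ {P Q : Set} (d : Dec P) (e : Dec Q) → (P → Q) → (Q → P) → 𝟙 d ≡ 𝟙 e
𝟙-cong (yes p) e f g = sym (𝟙-yes e (f p))
𝟙-cong (no ¬p) e f g = sym (𝟙-no e (λ q → ¬p (g q)))

δ : ∀ {n} → Fin n → Fin n → ℤ
δ i j = 𝟙 (i ≟ j)

sum-δ : ∀ {n} (i : Fin n) (f : Fin n → ℤ) → sum (λ j → δ i j * f j) ≡ f i
sum-δ zero f = trans (cong₂ _+_ (*-identityˡ (f zero)) (sum-zero (λ j → zeroˡ (f (suc j)))))
    (+-identityʳ (f zero))
sum-δ (suc i) f = trans (cong₂ _+_ (zeroˡ (f zero)) (sum-δ i (λ j → f (suc j)))) (+-identityˡ _)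

sum-δ-1 : ∀ {n} (i : Fin n) → sum (δ i) ≡ + 1
sum-δ-1 i = trans (sum-cong-≗ (λ j → sym (trans (*-comm (δ i j) (+ 1)) (*-identityˡ _))))
    (sum-δ i (λ _ → + 1))

-- Linear algebra over the integers

module LinearAlgebra (n : ℕ) where

  Function Matrix : Set
  Function = Fin n → ℤ
  Matrix = Fin n → Fin n → ℤ

  ⟨_,_⟩ : Function → Function → ℤ
  ⟨ f , g ⟩ = sum (λ x → f x * g x)

  infixr 8 _·_
  _·_ : Matrix → Function → Function
  (M · f) x = ⟨ M x , f ⟩

  Symmetric : Matrix → Set
  Symmetric M = ∀ x y → M x y ≡ M y x

  ip-comm : ∀ f g → ⟨ f , g ⟩ ≡ ⟨ g , f ⟩
  ip-comm f g = sum-cong-≗ (λ x → *-comm (f x) (g x))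

  ip-cong : ∀ {f f′ g g′} → f ≗ f′ → g ≗ g′ → ⟨ f , g ⟩ ≡ ⟨ f′ , g′ ⟩
  ip-cong p q = sum-cong-≗ (λ x → cong₂ _*_ (p x) (q x))

  ip-congˡ : ∀ {f f′} g → f ≗ f′ → ⟨ f , g ⟩ ≡ ⟨ f′ , g ⟩
  ip-congˡ g p = ip-cong p (λ _ → refl)

  ip-congʳ : ∀ f {g g′} → g ≗ g′ → ⟨ f , g ⟩ ≡ ⟨ f , g′ ⟩
  ip-congʳ f q = ip-cong (λ _ → refl) q

  -- Combinations of two functions are padded with a third of coefficient 0, which explains the many
  -- summands `+ 0 * _` below.
  linear₃ : ℤ → ℤ → ℤ → Function → Function → Function → Function
  linear₃ α β γ f g h x = α * f x + β * g x + γ * h x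

  ip-linearʳ : ∀ α β γ f g h k → ⟨ k , linear₃ α β γ f g h ⟩ ≡ α * ⟨ k , f ⟩ + β * ⟨ k , g ⟩ + γ
      * ⟨ k , h ⟩
  ip-linearʳ α β γ f g h k = trans
    (sum-cong-≗ (λ x → solve 7 (λ α β γ f g h k → k :* (α :* f :+ β :* g :+ γ :* h) := α :* (k :* f)
        :+ β :* (k :* g) :+ γ :* (k :* h)) refl α β γ (f x) (g x) (h x) (k x)))
    (sum-linear₃ α β γ (λ x → k x * f x) (λ x → k x * g x) (λ x → k x * h x))

  ip-linearˡ : ∀ α β γ f g h k → ⟨ linear₃ α β γ f g h , k ⟩ ≡ α * ⟨ f , k ⟩ + β * ⟨ g , k ⟩ + γ
      * ⟨ h , k ⟩
  ip-linearˡ α β γ f g h k = trans (ip-comm _ k) (trans (ip-linearʳ α β γ f g h k)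
    (cong₂ _+_ (cong₂ _+_ (cong (α *_) (ip-comm k f)) (cong (β *_) (ip-comm k g)))
        (cong (γ *_) (ip-comm k h))))

  ip-scaleʳ : ∀ α f g → ⟨ f , (λ x → α * g x) ⟩ ≡ α * ⟨ f , g ⟩
  ip-scaleʳ α f g = trans (sum-cong-≗
      (λ x → solve 3 (λ α f g → f :* (α :* g) := α :* (f :* g)) refl α (f x) (g x)))
      (sym (*-distribˡ-sum α (λ x → f x * g x)))

  ip-scaleˡ : ∀ α f g → ⟨ (λ x → α * f x) , g ⟩ ≡ α * ⟨ f , g ⟩
  ip-scaleˡ α f g = trans (ip-comm _ g) (trans (ip-scaleʳ α g f) (cong (α *_) (ip-comm g f)))

  ip-δ : ∀ x f → ⟨ δ x , f ⟩ ≡ f x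
  ip-δ = sum-δ

  ip-δʳ : ∀ f x → ⟨ f , δ x ⟩ ≡ f x
  ip-δʳ f x = trans (ip-comm f (δ x)) (sum-δ x f)

  ip-self-nonneg : ∀ f → + 0 ≤ ⟨ f , f ⟩
  ip-self-nonneg f = sum-nonneg (λ x → square-nonneg (f x))

  ip-self-zero : ∀ f → ⟨ f , f ⟩ ≡ + 0 → ∀ x → f x ≡ + 0
  ip-self-zero f p x = square-zero (sum-zero-nonneg (λ y → square-nonneg (f y)) p x)

  ip-sumʳ : ∀ {m} f (g : Fin m → Function) → ⟨ f , (λ x → sum (λ i → g i x)) ⟩ ≡ sum
      (λ i → ⟨ f , g i ⟩)
  ip-sumʳ f g = trans (sum-cong-≗ (λ x → *-distribˡ-sum (f x) (λ i → g i x)))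
      (∑-comm (λ x i → f x * g i x))

  ·-cong : ∀ M {f g} → f ≗ g → M · f ≗ M · g
  ·-cong M p x = ip-congʳ (M x) p

  ·-linear : ∀ M α β γ f g h → M · linear₃ α β γ f g h ≗ linear₃ α β γ (M · f) (M · g) (M · h)
  ·-linear M α β γ f g h x = ip-linearʳ α β γ f g h (M x)

  ·-δ : ∀ M y x → (M · δ y) x ≡ M x y
  ·-δ M y x = ip-δʳ (M x) y

  ·-adjoint : ∀ {M} → Symmetric M → ∀ f g → ⟨ f , M · g ⟩ ≡ ⟨ M · f , g ⟩
  ·-adjoint {M} s f g = trans
    (sum-cong-≗ (λ x → *-distribˡ-sum (f x) (λ y → M x y * g y)))
    (trans (∑-comm (λ x y → f x * (M x y * g y)))
    (sum-cong-≗ (λ y → trans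
      (sum-cong-≗ (λ x → trans (solve 3 (λ f m g → f :* (m :* g) := (m :* f) :* g) refl (f x)
          (M x y) (g y)) (cong (λ m → m * f x * g y) (s x y))))
      (sym (*-distribʳ-sum (g y) (λ x → M y x * f x))))))

  module _ {M : Matrix} (symmetric : Symmetric M) (c : ℕ)
      (square : ∀ f → M · M · f ≗ λ x → + suc c * (M · f) x) where

    private
      norm : ∀ f → ⟨ M · f , M · f ⟩ ≡ + suc c * ⟨ f , M · f ⟩
      norm f = trans (sym (·-adjoint symmetric f (M · f)))
          (trans (ip-congʳ f (square f)) (ip-scaleʳ (+ suc c) f (M · f)))

    -- Symmetry and M² = (c + 1) M give (c + 1) ⟨ f , M f ⟩ = ⟨ M f , M f ⟩. This takes the place of
    -- the spectral theorem and stays within ℤ.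
    form-nonneg : ∀ f → + 0 ≤ ⟨ f , M · f ⟩
    form-nonneg f = *-nonneg-cancelˡ c (subst (+ 0 ≤_) (norm f) (ip-self-nonneg (M · f)))

    form-zero : ∀ f → ⟨ f , M · f ⟩ ≡ + 0 → ∀ x → (M · f) x ≡ + 0
    form-zero f p = ip-self-zero (M · f)
        (trans (norm f) (trans (cong (+ suc c *_) p) (zeroʳ (+ suc c))))

  -- Coefficient lists starting with the constant term, multiplied with the
  -- transparent operations of ℤ so that products of literals evaluate.
  Poly : Set
  Poly = List ℤ

  infixl 6 _⊕_
  infixl 7 _⊗_

  _⊕_ : Poly → Poly → Poly
  [] ⊕ q = q
  p@(_ ∷ _) ⊕ [] = p
  (a ∷ p) ⊕ (b ∷ q) = a ℤ.+ b ∷ p ⊕ q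

  scale : ℤ → Poly → Poly
  scale a [] = []
  scale a (b ∷ q) = a ℤ.* b ∷ scale a q

  _⊗_ : Poly → Poly → Poly
  [] ⊗ q = []
  (a ∷ p) ⊗ q = scale a q ⊕ (+ 0 ∷ p ⊗ q)

  -- The linear functional on polynomials that sends the k-th power of the variable to `y k`. With
  -- `y k` the inner product of f and Lᵏ f it expresses quadratic forms in p(L) through walk counts.
  moment : Poly → (ℕ → ℤ) → ℤ
  moment [] y = + 0
  moment (a ∷ p) y = a * y 0 + moment p (λ k → y (suc k))

  horner : ℤ → Poly → ℤ
  horner t [] = + 0
  horner t (a ∷ p) = a ℤ.+ t ℤ.* horner t p

  module Polynomials (L : Matrix) (L-sym : Symmetric L) where

    pow : ℕ → Function → Function
    pow zero f = f
    pow (suc k) f = L · pow k f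

    poly : Poly → Function → Function
    poly [] f x = + 0
    poly (a ∷ p) f x = a * f x + (L · poly p f) x

    poly-cong : ∀ p {f g} → f ≗ g → poly p f ≗ poly p g
    poly-cong [] e x = refl
    poly-cong (a ∷ p) e x = cong₂ _+_ (cong (a *_) (e x)) (·-cong L (poly-cong p e) x)

    pow-cong : ∀ k {f g} → f ≗ g → pow k f ≗ pow k g
    pow-cong zero e = e
    pow-cong (suc k) e = ·-cong L (pow-cong k e)

    ·-0 : ∀ x → (L · λ _ → + 0) x ≡ + 0
    ·-0 x = sum-zero (λ y → zeroʳ (L x y))

    ·-+ : ∀ a f g x → (L · λ y → a * f y + g y) x ≡ a * (L · f) x + (L · g) x
    ·-+ a f g x = trans (·-cong L (λ y → solve 3
        (λ a f g → a :* f :+ g := a :* f :+ κ 1 :* g :+ κ 0 :* g) refl a (f y) (g y)) x)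
      (trans (·-linear L a (+ 1) (+ 0) f g g x)
          (solve 3 (λ a f g → a :* f :+ κ 1 :* g :+ κ 0 :* g := a :* f :+ g) refl a ((L · f) x)
          ((L · g) x)))

    poly-· : ∀ p f → poly p (L · f) ≗ L · poly p f
    poly-· [] f x = sym (·-0 x)
    poly-· (a ∷ p) f x = trans (cong (λ z → a * (L · f) x + z) (·-cong L (poly-· p f) x))
        (sym (·-+ a f (L · poly p f) x))

    poly-⊕ : ∀ p q f x → poly (p ⊕ q) f x ≡ poly p f x + poly q f x
    poly-⊕ [] q f x = sym (+-identityˡ _)
    poly-⊕ (a ∷ p) [] f x = sym (+-identityʳ _)
    poly-⊕ (a ∷ p) (b ∷ q) f x = trans (cong₂ _+_ (cong (_* f x) (+-homo a b))
        (trans (·-cong L (λ y → trans (poly-⊕ p q f y)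
            (cong (_+ poly q f y) (sym (*-identityˡ (poly p f y))))) x)
            (·-+ (+ 1) (poly p f) (poly q f) x)))
      (solve 5 (λ a b f p q → (a :+ b) :* f :+ (κ 1 :* p :+ q) := (a :* f :+ p) :+ (b :* f :+ q))
          refl a b (f x) ((L · poly p f) x) ((L · poly q f) x))

    poly-scale : ∀ a q f x → poly (scale a q) f x ≡ a * poly q f x
    poly-scale a [] f x = sym (zeroʳ a)
    poly-scale a (b ∷ q) f x = trans (cong₂ _+_ (cong (_* f x) (*-homo a b))
        (trans (·-cong L (λ y → trans (poly-scale a q f y) (sym (+-identityʳ _))) x)
            (trans (·-+ a (poly q f) (λ _ → + 0) x)
            (trans (cong (λ z → a * (L · poly q f) x + z) (·-0 x)) (+-identityʳ _)))))
      (solve 4 (λ a b f q → a :* b :* f :+ a :* q := a :* (b :* f :+ q)) refl a b (f x)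
          ((L · poly q f) x))

    poly-⊗ : ∀ p q f → poly (p ⊗ q) f ≗ poly p (poly q f)
    poly-⊗ [] q f x = refl
    poly-⊗ (a ∷ p) q f x = trans (poly-⊕ (scale a q) (+ 0 ∷ p ⊗ q) f x)
      (cong₂ _+_ (poly-scale a q f x)
          (trans (cong₂ _+_ (zeroˡ (f x)) (·-cong L (poly-⊗ p q f) x)) (+-identityˡ _)))

    ip-+ʳ : ∀ a f g h → ⟨ h , (λ y → a * f y + g y) ⟩ ≡ a * ⟨ h , f ⟩ + ⟨ h , g ⟩
    ip-+ʳ a f g h = trans (sum-cong-≗
        (λ y → solve 4 (λ a f g h → h :* (a :* f :+ g) := h :* (a :* f) :+ h :* g) refl a (f y)
        (g y) (h y)))
      (trans (∑-distrib-+ (λ y → h y * (a * f y)) (λ y → h y * g y))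
          (cong (_+ ⟨ h , g ⟩) (ip-scaleʳ a h f)))

    poly-adjoint : ∀ p f g → ⟨ f , poly p g ⟩ ≡ ⟨ poly p f , g ⟩
    poly-adjoint [] f g = trans (sum-zero (λ x → zeroʳ (f x))) (sym (sum-zero (λ x → zeroˡ (g x))))
    poly-adjoint (a ∷ p) f g = trans (ip-+ʳ a g (L · poly p g) f)
      (trans (cong₂ _+_ (cong (a *_) (ip-comm f g))
          (trans (·-adjoint L-sym f (poly p g))
          (trans (poly-adjoint p (L · f) g)
          (trans (ip-congˡ g (poly-· p f)) (ip-comm (L · poly p f) g)))))
      (trans (sym (ip-+ʳ a f (L · poly p f) g)) (ip-comm g _)))

    ip-poly : ∀ p f g → ⟨ f , poly p g ⟩ ≡ moment p (λ k → ⟨ f , pow k g ⟩)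
    ip-poly [] f g = sum-zero (λ x → zeroʳ (f x))
    ip-poly (a ∷ p) f g = trans (ip-+ʳ a g (L · poly p g) f) (cong (λ z → a * ⟨ f , g ⟩ + z)
      (trans (ip-congʳ f (λ x → sym (poly-· p g x)))
          (trans (ip-poly p f (L · g)) (moment-cong p (λ k → ip-congʳ f (pow-· k g))))))
      where
      moment-cong : ∀ p {y z : ℕ → ℤ} → y ≗ z → moment p y ≡ moment p z
      moment-cong [] e = refl
      moment-cong (a ∷ p) e = cong₂ _+_ (cong (a *_) (e 0)) (moment-cong p (λ k → e (suc k)))
      pow-· : ∀ k g → pow k (L · g) ≗ L · pow k g
      pow-· zero g x = refl
      pow-· (suc k) g = ·-cong L (pow-· k g)

    -- As `L` is symmetric, p(L) can be moved to the other side, so all quadratic expressions in one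
    -- function reduce to its moments. For literal polynomials `p ⊗ q` computes, and the
    -- coefficients appear as numerals in the `evaluate` lemmas below.
    ip-poly-poly : ∀ p q f → ⟨ poly p f , poly q f ⟩ ≡ moment (p ⊗ q) (λ k → ⟨ f , pow k f ⟩)
    ip-poly-poly p q f = trans (sym (poly-adjoint p f (poly q f)))
        (trans (ip-congʳ f (λ x → sym (poly-⊗ p q f x))) (ip-poly (p ⊗ q) f f))

    poly-eigen : ∀ p {f t} → (∀ x → (L · f) x ≡ t * f x) → ∀ x → poly p f x ≡ horner t p * f x
    poly-eigen [] e x = sym (zeroˡ _)
    poly-eigen (a ∷ p) {f} {t} e x = trans (cong (λ z → a * f x + z)
        (trans (·-cong L (λ y → trans (poly-eigen p e y) (sym (+-identityʳ _))) x)
        (trans (·-+ (horner t p) f (λ _ → + 0) x)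
            (trans (cong₂ _+_ (cong (horner t p *_) (e x)) (·-0 x)) (+-identityʳ _)))))
      (trans (solve 4 (λ a f h t → a :* f :+ h :* (t :* f) := (a :+ t :* h) :* f) refl a (f x)
          (horner t p) t)
        (cong (_* f x) (sym (trans (+-homo a _) (cong (λ z → a + z) (*-homo t _))))))

module DistanceRegular (n : ℕ) (G : SimpleGraph n)
  (dr : IsDistanceRegular G 4 (32 ∷ 27 ∷ 9 ∷ 1 ∷ []) (1 ∷ 3 ∷ 27 ∷ 32 ∷ [])) where

  open LinearAlgebra n
  open SimpleGraph G renaming (sym to Adj-sym)
  open Data.List.Membership.DecPropositional (_≟_ {n}) using (_∈?_)

  -- Distances and intersection numbers

  V : Set
  V = Fin n

  snoc : ∀ {k u v w} → Walk G k u v → Adj v w → Walk G (suc k) u w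
  snoc nil e = cons e nil
  snoc (cons f p) e = cons f (snoc p e)

  reverse : ∀ {k u v} → Walk G k u v → Walk G k v u
  reverse nil = nil
  reverse (cons e p) = snoc (reverse p) (Adj-sym e)

  Dist-unique : ∀ {v w i j} → Dist G v w i → Dist G v w j → i ≡ j
  Dist-unique {i = i} {j} (p , p-min) (q , q-min) with ℕₚ.<-cmp i j
  ... | tri< i<j _ _ = ⊥-elim (q-min i i<j p)
  ... | tri≈ _ e _ = e
  ... | tri> _ _ j<i = ⊥-elim (p-min j j<i q)

  d : V → V → ℕ
  d v w = proj₁ (proj₁ (proj₁ dr) v w)

  d-Dist : ∀ v w → Dist G v w (d v w)
  d-Dist v w = proj₂ (proj₁ (proj₁ dr) v w)

  Dist⇒d : ∀ {v w i} → Dist G v w i → d v w ≡ i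
  Dist⇒d = Dist-unique (d-Dist _ _)

  d⇒Dist : ∀ {v w i} → d v w ≡ i → Dist G v w i
  d⇒Dist refl = d-Dist _ _

  d-≤-walk : ∀ {k v w} → Walk G k v w → d v w ℕ.≤ k
  d-≤-walk {k} {v} {w} p = ℕₚ.≮⇒≥ (λ k<d → proj₂ (d-Dist v w) k k<d p)

  d-≤-4 : ∀ v w → d v w ℕ.≤ 4
  d-≤-4 v w = proj₁ (proj₂ (proj₁ dr)) v w (d v w) (d-Dist v w)

  d-sym : ∀ v w → d v w ≡ d w v
  d-sym v w = ℕₚ.≤-antisym (d-≤-walk (reverse (proj₁ (d-Dist w v))))
      (d-≤-walk (reverse (proj₁ (d-Dist v w))))

  d-refl : ∀ v → d v v ≡ 0
  d-refl v = ℕₚ.n≤0⇒n≡0 (d-≤-walk nil)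

  d≡0⇒≡ : ∀ {v w} → d v w ≡ 0 → v ≡ w
  d≡0⇒≡ {v} {w} e with subst (λ k → Walk G k v w) e (proj₁ (d-Dist v w))
  ... | nil = refl

  d≡1⇒Adj : ∀ {v w} → d v w ≡ 1 → Adj v w
  d≡1⇒Adj {v} {w} e with subst (λ k → Walk G k v w) e (proj₁ (d-Dist v w))
  ... | cons f nil = f

  d-≤-suc : ∀ {v u w} → Adj u w → d v w ℕ.≤ suc (d v u)
  d-≤-suc {v} {u} f = d-≤-walk (snoc (proj₁ (d-Dist v u)) f)

  Adj⇒d≡1 : ∀ {v w} → Adj v w → d v w ≡ 1
  Adj⇒d≡1 {v} {w} f = ℕₚ.≤-antisym (d-≤-walk (cons f nil))
    (ℕₚ.n≢0⇒n>0 (λ e → irrefl (subst (Adj v) (sym (d≡0⇒≡ e)) f)))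

  A : V → V → ℤ
  A u w = 𝟙 (adj? u w)

  A-sym : ∀ u w → A u w ≡ A w u
  A-sym u w = 𝟙-cong (adj? u w) (adj? w u) Adj-sym Adj-sym

  multiplicity : List V → V → ℤ
  multiplicity [] u = + 0
  multiplicity (x ∷ L) u = δ x u + multiplicity L u

  sum-multiplicity : ∀ L → sum (multiplicity L) ≡ + length L
  sum-multiplicity [] = sum-zero {n} (λ _ → refl)
  sum-multiplicity (x ∷ L) = trans (∑-distrib-+ (δ x) (multiplicity L))
    (trans (cong₂ _+_ (sum-δ-1 x) (sum-multiplicity L))
           (sym (+-homo (+ 1) (+ length L))))

  multiplicity-∉ : ∀ L {u} → ¬ u ∈ L → multiplicity L u ≡ + 0
  multiplicity-∉ [] u∉ = refl
  multiplicity-∉ (x ∷ L) {u} u∉ = trans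
      (cong₂ _+_ (𝟙-no (x ≟ u) (λ e → u∉ (here (sym e)))) (multiplicity-∉ L (λ m → u∉ (there m))))
      (+-identityˡ (+ 0))

  multiplicity-∈ : ∀ {L u} → Unique L → u ∈ L → multiplicity L u ≡ + 1
  multiplicity-∈ {x ∷ L} {u} (x∉ ∷ _) (here e) = trans
      (cong₂ _+_ (𝟙-yes (x ≟ u) (sym e)) (multiplicity-∉ L (λ m → All.lookup x∉ m (sym e))))
      (+-identityʳ (+ 1))
  multiplicity-∈ {x ∷ L} {u} (x∉ ∷ U) (there m) = trans
      (cong₂ _+_ (𝟙-no (x ≟ u) (All.lookup x∉ m)) (multiplicity-∈ U m)) (+-identityˡ (+ 1))

  HasExactly⇒sum : ∀ {P k} (χ : V → ℤ) → HasExactly G P k →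
    (∀ u → P u → χ u ≡ + 1) → (∀ u → ¬ P u → χ u ≡ + 0) → sum χ ≡ + k
  HasExactly⇒sum {P} χ (L , refl , U , L⇔P) χ₁ χ₀ = trans (sum-cong-≗ χ≗) (sum-multiplicity L)
    where
    χ≗ : ∀ u → χ u ≡ multiplicity L u
    χ≗ u with u ∈? L
    ... | yes m = trans (χ₁ u (Equivalence.to (L⇔P u) m)) (sym (multiplicity-∈ U m))
    ... | no ¬m = trans (χ₀ u (λ p → ¬m (Equivalence.from (L⇔P u) p))) (sym (multiplicity-∉ L ¬m))

  at : V → ℕ → V → ℤ
  at v i u = 𝟙 (d v u ℕ.≟ i)

  neighbours-at : ∀ {v w i k} → HasExactly G (λ u → Adj w u × Dist G v u i) k →
    sum (λ u → A w u * at v i u) ≡ + k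
  neighbours-at {v} {w} {i} h = HasExactly⇒sum _ h
    (λ u (f , D) → cong₂ _*_ (𝟙-yes (adj? w u) f) (𝟙-yes (d v u ℕ.≟ i) (Dist⇒d D)) ∙ *-identityˡ
        (+ 1))
    λ u ¬p → no-such u ¬p
    where
    _∙_ = trans
    no-such : ∀ u → ¬ (Adj w u × Dist G v u i) → A w u * at v i u ≡ + 0
    no-such u ¬p with adj? w u
    ... | no _ = zeroˡ _
    ... | yes f = trans (*-identityˡ _) (𝟙-no (d v u ℕ.≟ i) (λ e → ¬p (f , d⇒Dist e)))

  B C : ℕ → ℤ
  B 0 = + 32
  B 1 = + 27
  B 2 = + 9
  B 3 = + 1
  B _ = + 0
  C 1 = + 1
  C 2 = + 3
  C 3 = + 27
  C 4 = + 32
  C _ = + 0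

  B-count : ∀ v w → sum (λ u → A w u * at v (suc (d v w)) u) ≡ B (d v w)
  B-count v w with d v w in e | d-≤-4 v w
  ... | 0 | _ = neighbours-at (proj₁ (proj₂ dr) zero v w (d⇒Dist e))
  ... | 1 | _ = neighbours-at (proj₁ (proj₂ dr) (suc zero) v w (d⇒Dist e))
  ... | 2 | _ = neighbours-at (proj₁ (proj₂ dr) (suc (suc zero)) v w (d⇒Dist e))
  ... | 3 | _ = neighbours-at (proj₁ (proj₂ dr) (suc (suc (suc zero))) v w (d⇒Dist e))
  -- b₄ = 0 is not part of the array; it holds because the diameter leaves no vertex at distance 5.
  ... | 4 | _ = sum-zero (λ u → trans
      (cong (A w u *_) (𝟙-no (d v u ℕ.≟ 5) (λ e′ → ℕₚ.<-irrefl e′ (s≤s (d-≤-4 v u))))) (zeroʳ _))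
  ... | suc (suc (suc (suc (suc _)))) | s≤s (s≤s (s≤s (s≤s ())))

  -- Comparing `suc (d v u)` with j, and not `d v u` with `pred j`, makes the indicator vanish at j
  -- = 0, in accordance with c₀ = 0.
  below : V → ℕ → V → ℤ
  below v j u = 𝟙 (suc (d v u) ℕ.≟ j)

  below-at : ∀ v i u → below v (suc i) u ≡ at v i u
  below-at v i u = 𝟙-cong (suc (d v u) ℕ.≟ suc i) (d v u ℕ.≟ i) ℕₚ.suc-injective (cong suc)

  C-count : ∀ v w → sum (λ u → A w u * below v (d v w) u) ≡ C (d v w)
  C-count v w with d v w in e | d-≤-4 v w
  ... | 0 | _ = sum-zero (λ u → zeroʳ (A w u))
  ... | 1 | _ = trans (sum-cong-≗ (λ u → cong (A w u *_) (below-at v 0 u)))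
      (neighbours-at (proj₂ (proj₂ dr) zero v w (d⇒Dist e)))
  ... | 2 | _ = trans (sum-cong-≗ (λ u → cong (A w u *_) (below-at v 1 u)))
      (neighbours-at (proj₂ (proj₂ dr) (suc zero) v w (d⇒Dist e)))
  ... | 3 | _ = trans (sum-cong-≗ (λ u → cong (A w u *_) (below-at v 2 u)))
      (neighbours-at (proj₂ (proj₂ dr) (suc (suc zero)) v w (d⇒Dist e)))
  ... | 4 | _ = trans (sum-cong-≗ (λ u → cong (A w u *_) (below-at v 3 u)))
      (neighbours-at (proj₂ (proj₂ dr) (suc (suc (suc zero))) v w (d⇒Dist e)))
  ... | suc (suc (suc (suc (suc _)))) | s≤s (s≤s (s≤s (s≤s ())))

  sum-A : ∀ w → sum (A w) ≡ + 32
  sum-A w = trans (sum-cong-≗ all-at-1)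
      (subst (λ i → sum (λ u → A w u * at w (suc i) u) ≡ B i) (d-refl w) (B-count w w))
    where
    all-at-1 : ∀ u → A w u ≡ A w u * at w 1 u
    all-at-1 u with adj? w u
    ... | no _ = sym (zeroˡ _)
    ... | yes f = sym (trans (*-identityˡ _) (𝟙-yes (d w u ℕ.≟ 1) (Adj⇒d≡1 f)))

  -- The action of the adjacency matrix on radial functions. Row i has the entries cᵢ, aᵢ, bᵢ, where
  -- aᵢ = 32 - bᵢ - cᵢ takes the values 0, 4, 20, 4, 0.
  tridiagonal : (ℕ → ℤ) → ℕ → ℤ
  tridiagonal k 0 = + 32 * k 1
  tridiagonal k 1 = k 0 + + 4 * k 1 + + 27 * k 2
  tridiagonal k 2 = + 3 * k 1 + + 20 * k 2 + + 9 * k 3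
  tridiagonal k 3 = + 27 * k 2 + + 4 * k 3 + k 4
  tridiagonal k 4 = + 32 * k 3
  tridiagonal k _ = + 0

  -- A neighbour of w lies at distance j - 1, j or j + 1 from v. Writing k as its value at j plus
  -- corrections on the two outer classes requires only the valency and the counts bⱼ, cⱼ, so the
  -- neighbours at distance j need not be counted separately.
  sum-neighbours : ∀ (k : ℕ → ℤ) v w → sum (λ u → A w u * k (d v u)) ≡ tridiagonal k (d v w)
  sum-neighbours k v w = trans (sum-cong-≗ split)
    (trans (sum-linear₃ (k j) (k (suc j) - k j) (k (pred j) - k j) (A w)
        (λ u → A w u * at v (suc j) u) (λ u → A w u * below v j u))
    (trans (cong₂ _+_ (cong₂ _+_ (cong (k j *_) (sum-A w))
        (cong ((k (suc j) - k j) *_) (B-count v w))) (cong ((k (pred j) - k j) *_) (C-count v w)))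
           (evaluate j (d-≤-4 v w))))
    where
    j = d v w
    split : ∀ u → A w u * k (d v u) ≡
      k j * A w u + (k (suc j) - k j) * (A w u * at v (suc j) u) + (k (pred j) - k j)
          * (A w u * below v j u)
    split u with adj? w u
    ... | no _ = solve 6 (λ a b c x y z → κ 0 :* x := a :* κ 0 :+ b :* (κ 0 :* y) :+ c
        :* (κ 0 :* z)) refl
                   (k j) (k (suc j) - k j) (k (pred j) - k j) (k (d v u)) (at v (suc j) u)
                       (below v j u)
    ... | yes f with d v u | d-≤-suc {v} f | d-≤-suc {v} (Adj-sym f)
    ... | i | i≤ | j≤ with ℕₚ.<-cmp i j
    ... | tri≈ _ refl _ = trans (solve 3
        (λ a b c → κ 1 :* a := a :* κ 1 :+ b :* (κ 1 :* κ 0) :+ c :* (κ 1 :* κ 0)) refl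
                   (k j) (k (suc j) - k j) (k (pred j) - k j))
        (cong₂ (λ s t → k j * + 1 + (k (suc j) - k j) * (+ 1 * s) + (k (pred j) - k j) * (+ 1 * t))
          (sym (𝟙-no (j ℕ.≟ suc j) (λ e → ℕₚ.1+n≢n (sym e)))) (sym (𝟙-no (suc j ℕ.≟ j) ℕₚ.1+n≢n)))
    ... | tri< i<j _ _ = go (ℕₚ.≤-antisym i<j j≤)
      where
      go : suc i ≡ j → _
      go e = trans (solve 4 (λ a b c x → κ 1 :* x := a :* κ 1 :+ b :* (κ 1 :* κ 0) :+ (x :- a)
          :* (κ 1 :* κ 1)) refl (k j) (k (suc j) - k j) (k j) (k i))
        (trans (cong (λ m → k j * + 1 + (k (suc j) - k j) * (+ 1 * + 0) + (k m - k j) * (+ 1 * + 1))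
            (cong pred e))
        (cong₂ (λ s t → k j * + 1 + (k (suc j) - k j) * (+ 1 * s) + (k (pred j) - k j) * (+ 1 * t))
          (sym (𝟙-no (i ℕ.≟ suc j) (λ q → ℕₚ.<-irrefl q (ℕₚ.≤-trans i<j (ℕₚ.n≤1+n j)))))
              (sym (𝟙-yes (suc i ℕ.≟ j) e))))
    ... | tri> _ _ j<i = go (ℕₚ.≤-antisym i≤ j<i)
      where
      go : i ≡ suc j → _
      go e = trans (solve 3 (λ a c x → κ 1 :* x := a :* κ 1 :+ (x :- a) :* (κ 1 :* κ 1) :+ c
          :* (κ 1 :* κ 0)) refl (k j) (k (pred j) - k j) (k i))
        (trans (cong (λ m → k j * + 1 + (k m - k j) * (+ 1 * + 1) + (k (pred j) - k j)
            * (+ 1 * + 0)) e)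
        (cong₂ (λ s t → k j * + 1 + (k (suc j) - k j) * (+ 1 * s) + (k (pred j) - k j) * (+ 1 * t))
          (sym (𝟙-yes (i ℕ.≟ suc j) e)) (sym
              (𝟙-no (suc i ℕ.≟ j) (λ q → ℕₚ.<-irrefl (sym q) (ℕₚ.≤-trans j<i (ℕₚ.n≤1+n i)))))))
    evaluate : ∀ j → j ℕ.≤ 4 →
      k j * + 32 + (k (suc j) - k j) * B j + (k (pred j) - k j) * C j ≡ tridiagonal k j
    evaluate 0 _ = solve 2 (λ x y → x :* κ 32 :+ (y :- x) :* κ 32 :+ (x :- x) :* κ 0 := κ 32 :* y)
        refl (k 0) (k 1)
    evaluate 1 _ = solve 3 (λ x y z → y :* κ 32 :+ (z :- y) :* κ 27 :+ (x :- y) :* κ 1 := x :+ κ 4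
        :* y :+ κ 27 :* z) refl (k 0) (k 1) (k 2)
    evaluate 2 _ = solve 3 (λ x y z → y :* κ 32 :+ (z :- y) :* κ 9 :+ (x :- y) :* κ 3 := κ 3 :* x
        :+ κ 20 :* y :+ κ 9 :* z) refl (k 1) (k 2) (k 3)
    evaluate 3 _ = solve 3 (λ x y z → y :* κ 32 :+ (z :- y) :* κ 1 :+ (x :- y) :* κ 27 := κ 27 :* x
        :+ κ 4 :* y :+ z) refl (k 2) (k 3) (k 4)
    evaluate 4 _ = solve 3 (λ x y z → y :* κ 32 :+ (z :- y) :* κ 0 :+ (x :- y) :* κ 32 := κ 32 :* x)
        refl (k 3) (k 4) (k 5)
    evaluate (suc (suc (suc (suc (suc _))))) (s≤s (s≤s (s≤s (s≤s ()))))

  -- Radial kernels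

  radial : (ℕ → ℤ) → Matrix
  radial k u v = k (d u v)

  radial-sym : ∀ k → Symmetric (radial k)
  radial-sym k u v = cong k (d-sym u v)

  infix 4 _≈₄_
  -- Equality is asked only up to the diameter, since for instance `tridiagonal e` and -10 `e`
  -- differ beyond it.
  _≈₄_ : (ℕ → ℤ) → (ℕ → ℤ) → Set
  k ≈₄ l = ∀ j → j ℕ.≤ 4 → k j ≡ l j

  ≈₄-intro : ∀ {k l} → k 0 ≡ l 0 → k 1 ≡ l 1 → k 2 ≡ l 2 → k 3 ≡ l 3 → k 4 ≡ l 4 → k ≈₄ l
  ≈₄-intro e₀ e₁ e₂ e₃ e₄ 0 _ = e₀
  ≈₄-intro e₀ e₁ e₂ e₃ e₄ 1 _ = e₁
  ≈₄-intro e₀ e₁ e₂ e₃ e₄ 2 _ = e₂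
  ≈₄-intro e₀ e₁ e₂ e₃ e₄ 3 _ = e₃
  ≈₄-intro e₀ e₁ e₂ e₃ e₄ 4 _ = e₄
  ≈₄-intro e₀ e₁ e₂ e₃ e₄ (suc (suc (suc (suc (suc _))))) (s≤s (s≤s (s≤s (s≤s ()))))

  radial-cong : ∀ {k l} → k ≈₄ l → ∀ f → radial k · f ≗ radial l · f
  radial-cong e f v = ip-congˡ f (λ u → e (d v u) (d-≤-4 v u))

  radial-linear : ∀ α β γ k l m f v → (radial (λ j → α * k j + β * l j + γ * m j) · f) v ≡
    α * (radial k · f) v + β * (radial l · f) v + γ * (radial m · f) v
  radial-linear α β γ k l m f v = ip-linearˡ α β γ (radial k v) (radial l v) (radial m v) f

  -- Radial kernels are closed under multiplication by `A`: they form the Bose-Mesner algebra, in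
  -- which the identities below take place.
  A-·-radial : ∀ k f → A · radial k · f ≗ radial (tridiagonal k) · f
  A-·-radial k f v = trans (·-adjoint (radial-sym k) (A v) f) (ip-congˡ f (λ u →
    trans (sum-cong-≗ (λ w → *-comm (k (d u w)) (A v w)))
        (trans (sum-neighbours k u v) (cong (tridiagonal k) (d-sym u v)))))

  unit : ℕ → ℕ → ℤ
  unit i j = 𝟙 (j ℕ.≟ i)

  opaque
    unfolding _+_

    expand-radial : ∀ k → k ≈₄ λ j → + 1 * (k 0 * unit 0 j + k 1 * unit 1 j + k 2 * unit 2 j) + k 3
        * unit 3 j + k 4 * unit 4 j
    expand-radial k = ≈₄-intro
      (solve 5 (λ a b c d e → a := κ 1 :* (a :* κ 1 :+ b :* κ 0 :+ c :* κ 0) :+ d :* κ 0 :+ e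
          :* κ 0) refl (k 0) (k 1) (k 2) (k 3) (k 4))
      (solve 5 (λ a b c d e → b := κ 1 :* (a :* κ 0 :+ b :* κ 1 :+ c :* κ 0) :+ d :* κ 0 :+ e
          :* κ 0) refl (k 0) (k 1) (k 2) (k 3) (k 4))
      (solve 5 (λ a b c d e → c := κ 1 :* (a :* κ 0 :+ b :* κ 0 :+ c :* κ 1) :+ d :* κ 0 :+ e
          :* κ 0) refl (k 0) (k 1) (k 2) (k 3) (k 4))
      (solve 5 (λ a b c d e → d := κ 1 :* (a :* κ 0 :+ b :* κ 0 :+ c :* κ 0) :+ d :* κ 1 :+ e
          :* κ 0) refl (k 0) (k 1) (k 2) (k 3) (k 4))
      (solve 5 (λ a b c d e → e := κ 1 :* (a :* κ 0 :+ b :* κ 0 :+ c :* κ 0) :+ d :* κ 0 :+ e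
          :* κ 1) refl (k 0) (k 1) (k 2) (k 3) (k 4))

    tridiagonal-unit₀ : tridiagonal (unit 0) ≈₄ unit 1
    tridiagonal-unit₀ = ≈₄-intro refl refl refl refl refl

    tridiagonal-unit₁ : tridiagonal (unit 1) ≈₄ λ j → + 32 * unit 0 j + + 4 * unit 1 j + + 3 * unit
        2 j
    tridiagonal-unit₁ = ≈₄-intro refl refl refl refl refl

    tridiagonal-unit₂ : tridiagonal (unit 2) ≈₄ λ j → + 27 * unit 1 j + + 20 * unit 2 j + + 27
        * unit 3 j
    tridiagonal-unit₂ = ≈₄-intro refl refl refl refl refl

    tridiagonal-unit₃ : tridiagonal (unit 3) ≈₄ λ j → + 9 * unit 2 j + + 4 * unit 3 j + + 32 * unit
        4 j
    tridiagonal-unit₃ = ≈₄-intro refl refl refl refl refl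

  -- Eigenfunctions of the adjacency matrix under radial kernels

  module Eigenfunction {y : Function} {θ : ℤ} (eigen : ∀ v → (A · y) v ≡ θ * y v) where

    private
      step : ∀ {k ρ} → (∀ v → (radial k · y) v ≡ ρ * y v) → ∀ v → (radial (tridiagonal k) · y) v ≡ ρ
          * (θ * y v)
      step {k} {ρ} h v = trans (sym (A-·-radial k y v))
          (trans (·-cong A h v) (trans (ip-scaleʳ ρ (A v) y) (cong (ρ *_) (eigen v))))

      unit₀ : ∀ v → (radial (unit 0) · y) v ≡ + 1 * y v
      unit₀ v = trans (ip-congˡ y (λ u → 𝟙-cong (d v u ℕ.≟ 0) (v ≟ u) d≡0⇒≡
          (λ { refl → d-refl v })))
        (trans (ip-δ v y) (sym (*-identityˡ (y v))))

      unit₁ : ∀ v → (radial (unit 1) · y) v ≡ θ * y v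
      unit₁ v = trans (sym (radial-cong tridiagonal-unit₀ y v))
          (trans (step unit₀ v) (*-identityˡ _))

    module _ {ρ₂ ρ₃ ρ₄ : ℤ}
      (e₂ : + 3 * ρ₂ ≡ θ * θ - + 32 - + 4 * θ)
      (e₃ : + 27 * ρ₃ ≡ θ * ρ₂ - + 27 * θ - + 20 * ρ₂)
      (e₄ : + 32 * ρ₄ ≡ θ * ρ₃ - + 9 * ρ₂ - + 4 * ρ₃) where

      private
        unit₂ : ∀ v → (radial (unit 2) · y) v ≡ ρ₂ * y v
        unit₂ v = *-cancelˡ 2 (trans
          (solve 3 (λ x a b → κ 3 :* x := (κ 32 :* a :+ κ 4 :* b :+ κ 3 :* x) :- κ 32 :* a :- κ 4
              :* b) refl ((radial (unit 2) · y) v) ((radial (unit 0) · y) v)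
              ((radial (unit 1) · y) v))
          (trans (cong₂ _-_ (cong₂ (λ s t → s - + 32 * t)
              (trans (sym (radial-linear (+ 32) (+ 4) (+ 3) (unit 0) (unit 1) (unit 2) y v))
                  (trans (sym (radial-cong tridiagonal-unit₁ y v)) (step unit₁ v)))
              (unit₀ v)) (cong (+ 4 *_) (unit₁ v)))
          (trans (solve 2 (λ θ y → θ :* (θ :* y) :- κ 32 :* (κ 1 :* y) :- κ 4 :* (θ :* y)
              := (θ :* θ :- κ 32 :- κ 4 :* θ) :* y) refl θ (y v))
          (trans (cong (_* y v) (sym e₂)) (*-assoc _ _ _)))))

        unit₃ : ∀ v → (radial (unit 3) · y) v ≡ ρ₃ * y v
        unit₃ v = *-cancelˡ 26 (trans
          (solve 3 (λ x a b → κ 27 :* x := (κ 27 :* a :+ κ 20 :* b :+ κ 27 :* x) :- κ 27 :* a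
              :- κ 20 :* b) refl ((radial (unit 3) · y) v) ((radial (unit 1) · y) v)
              ((radial (unit 2) · y) v))
          (trans (cong₂ _-_ (cong₂ (λ s t → s - + 27 * t)
              (trans (sym (radial-linear (+ 27) (+ 20) (+ 27) (unit 1) (unit 2) (unit 3) y v))
                  (trans (sym (radial-cong tridiagonal-unit₂ y v)) (step unit₂ v)))
              (unit₁ v)) (cong (+ 20 *_) (unit₂ v)))
          (trans (solve 3 (λ θ ρ y → ρ :* (θ :* y) :- κ 27 :* (θ :* y) :- κ 20 :* (ρ :* y)
              := (θ :* ρ :- κ 27 :* θ :- κ 20 :* ρ) :* y) refl θ ρ₂ (y v))
          (trans (cong (_* y v) (sym e₃)) (*-assoc _ _ _)))))

        unit₄ : ∀ v → (radial (unit 4) · y) v ≡ ρ₄ * y v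
        unit₄ v = *-cancelˡ 31 (trans
          (solve 3 (λ x a b → κ 32 :* x := (κ 9 :* a :+ κ 4 :* b :+ κ 32 :* x) :- κ 9 :* a :- κ 4
              :* b) refl ((radial (unit 4) · y) v) ((radial (unit 2) · y) v)
              ((radial (unit 3) · y) v))
          (trans (cong₂ _-_ (cong₂ (λ s t → s - + 9 * t)
              (trans (sym (radial-linear (+ 9) (+ 4) (+ 32) (unit 2) (unit 3) (unit 4) y v))
                  (trans (sym (radial-cong tridiagonal-unit₃ y v)) (step unit₃ v)))
              (unit₂ v)) (cong (+ 4 *_) (unit₃ v)))
          (trans (solve 4 (λ θ ρ σ y → σ :* (θ :* y) :- κ 9 :* (ρ :* y) :- κ 4 :* (σ :* y)
              := (θ :* σ :- κ 9 :* ρ :- κ 4 :* σ) :* y) refl θ ρ₂ ρ₃ (y v))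
          (trans (cong (_* y v) (sym e₄)) (*-assoc _ _ _)))))

      -- The distance-i matrix is a polynomial in `A`, so it multiplies y by a number ρᵢ. The
      -- hypotheses e₂, e₃, e₄ are the three-term recurrence for these numbers, with cᵢ₊₁ kept on
      -- the left to avoid division.
      radial-eigen : ∀ k v → (radial k · y) v ≡ (k 0 + k 1 * θ + k 2 * ρ₂ + k 3 * ρ₃ + k 4 * ρ₄) * y
          v
      radial-eigen k v = trans (radial-cong (expand-radial k) y v)
        (trans (radial-linear (+ 1) (k 3) (k 4)
            (λ j → k 0 * unit 0 j + k 1 * unit 1 j + k 2 * unit 2 j) (unit 3) (unit 4) y v)
        (trans (cong₂ _+_ (cong₂ _+_ (cong (+ 1 *_)
             (trans (radial-linear (k 0) (k 1) (k 2) (unit 0) (unit 1) (unit 2) y v)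
                 (cong₂ _+_ (cong₂ _+_ (cong (k 0 *_) (unit₀ v)) (cong (k 1 *_) (unit₁ v)))
                 (cong (k 2 *_) (unit₂ v)))))
             (cong (k 3 *_) (unit₃ v))) (cong (k 4 *_) (unit₄ v)))
        (solve 10 (λ a b c d e θ r s t y → κ 1
            :* (a :* (κ 1 :* y) :+ b :* (θ :* y) :+ c :* (r :* y)) :+ d :* (s :* y) :+ e :* (t :* y)
            := (a :+ b :* θ :+ c :* r :+ d :* s :+ e :* t) :* y) refl (k 0) (k 1) (k 2) (k 3) (k 4)
                θ ρ₂ ρ₃ ρ₄ (y v))))

  -- The cosine sequences of the eigenvalues -10 and 8, scaled to integers: E and
  -- Γ are multiples of the corresponding primitive idempotents.
  e g : ℕ → ℤ
  e 0 = + 16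
  e 1 = ℤ.- + 5
  e 2 = + 2
  e 3 = ℤ.- + 5
  e _ = + 16
  g 0 = + 12
  g 1 = + 3
  g 2 = + 0
  g 3 = ℤ.- + 1
  g _ = ℤ.- + 4

  E Γ : Matrix
  E = radial e
  Γ = radial g

  opaque
    unfolding _+_

    tridiagonal-e : tridiagonal e ≈₄ λ j → (ℤ.- + 10) * e j
    tridiagonal-e = ≈₄-intro refl refl refl refl refl

    tridiagonal-g : tridiagonal g ≈₄ λ j → (+ 8) * g j
    tridiagonal-g = ≈₄-intro refl refl refl refl refl

  radial-eigenfunction : ∀ {k θ} → tridiagonal k ≈₄ (λ j → θ * k j) → ∀ f v → (A · radial k · f) v
      ≡ θ * (radial k · f) v
  radial-eigenfunction {k} {θ} h f v = trans (A-·-radial k f v)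
      (trans (radial-cong h f v) (ip-scaleˡ θ (radial k v) f))

  opaque
    unfolding _+_

    -- The components here and in the next two lemmas belong to the eigenvalues -10, 8 and 32. For
    -- 32 the numbers 288, 96, 3 are the sizes of the spheres of radius 2, 3, 4.
    recurrence₂ : (+ 3 * + 36 ≡ (ℤ.- + 10) * (ℤ.- + 10) - + 32 - + 4 * (ℤ.- + 10))
        × (+ 3 * + 0 ≡ + 8 * + 8 - + 32 - + 4 * + 8)
        × (+ 3 * + 288 ≡ + 32 * + 32 - + 32 - + 4 * + 32)
    recurrence₂ = refl , refl , refl

    recurrence₃ : (+ 27 * (ℤ.- + 30) ≡ (ℤ.- + 10) * + 36 - + 27 * (ℤ.- + 10) - + 20 * + 36)
        × (+ 27 * (ℤ.- + 8) ≡ + 8 * + 0 - + 27 * + 8 - + 20 * + 0)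
        × (+ 27 * + 96 ≡ + 32 * + 288 - + 27 * + 32 - + 20 * + 288)
    recurrence₃ = refl , refl , refl

    recurrence₄ : (+ 32 * + 3 ≡ (ℤ.- + 10) * (ℤ.- + 30) - + 9 * + 36 - + 4 * (ℤ.- + 30))
        × (+ 32 * (ℤ.- + 1) ≡ + 8 * (ℤ.- + 8) - + 9 * + 0 - + 4 * (ℤ.- + 8))
        × (+ 32 * + 3 ≡ + 32 * + 96 - + 9 * + 288 - + 4 * + 96)
    recurrence₄ = refl , refl , refl

    -- The first two values are (order) · (diagonal entry) / (multiplicity): 336 = 420 · 16 / 20 and
    -- 48 = 420 · 12 / 105. The third is the order 420.
    eigenvalues : (+ 16 + (ℤ.- + 5) * (ℤ.- + 10) + + 2 * + 36 + (ℤ.- + 5) * (ℤ.- + 30) + + 16 * + 3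
        ≡ + 336)
      × (+ 12 + + 3 * + 8 + + 0 * + 0 + (ℤ.- + 1) * (ℤ.- + 8) + (ℤ.- + 4) * (ℤ.- + 1) ≡ + 48)
      × (+ 1 + + 1 * + 32 + + 1 * + 288 + + 1 * + 96 + + 1 * + 3 ≡ + 420)
    eigenvalues = refl , refl , refl

  E-eigen : ∀ {y} → (∀ v → (A · y) v ≡ (ℤ.- + 10) * y v) → ∀ v → (E · y) v ≡ + 336 * y v
  E-eigen {y} h v = trans (Eigenfunction.radial-eigen {y} {ℤ.- + 10} h {+ 36} {ℤ.- + 30} {+ 3}
      (proj₁ recurrence₂) (proj₁ recurrence₃) (proj₁ recurrence₄) e v)
    (cong (_* y v) (proj₁ eigenvalues))

  Γ-eigen : ∀ {y} → (∀ v → (A · y) v ≡ + 8 * y v) → ∀ v → (Γ · y) v ≡ + 48 * y v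
  Γ-eigen {y} h v = trans (Eigenfunction.radial-eigen {y} {+ 8} h {+ 0} {ℤ.- + 8} {ℤ.- + 1}
      (proj₁ (proj₂ recurrence₂)) (proj₁ (proj₂ recurrence₃)) (proj₁ (proj₂ recurrence₄)) g v)
    (cong (_* y v) (proj₁ (proj₂ eigenvalues)))

  -- The constant function is an eigenfunction for 32, and the radial kernel constantly 1 sums it
  -- over all vertices. A vertex is required at which to evaluate that kernel.
  sum-1 : V → sum {n} (λ _ → + 1) ≡ + 420
  sum-1 v = trans (sum-cong-≗ {n} (λ _ → sym (*-identityˡ (+ 1))))
    (trans (Eigenfunction.radial-eigen {λ _ → + 1} {+ 32}
        (λ w → trans (ip-comm (A w) (λ _ → + 1))
        (trans (sum-cong-≗ (λ u → *-identityˡ (A w u)))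
        (trans (sum-A w) (sym (trans (*-comm (+ 32) (+ 1)) (*-identityˡ (+ 32)))))))
      {+ 288} {+ 96} {+ 3} (proj₂ (proj₂ recurrence₂)) (proj₂ (proj₂ recurrence₃))
          (proj₂ (proj₂ recurrence₄)) (λ _ → + 1) v)
    (trans (cong (_* + 1) (proj₂ (proj₂ eigenvalues)))
        (trans (*-comm (+ 420) (+ 1)) (*-identityˡ (+ 420)))))

  E-square : ∀ f → E · E · f ≗ λ x → + 336 * (E · f) x
  E-square f = E-eigen (radial-eigenfunction tridiagonal-e f)

  Γ-square : ∀ f → Γ · Γ · f ≗ λ x → + 48 * (Γ · f) x
  Γ-square f = Γ-eigen (radial-eigenfunction tridiagonal-g f)

  module Neighbourhood (v : Fin n) where

    -- The local graph

    a : Function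
    a = A v

    L : Matrix
    L x y = a x * A x y * a y

    L-sym : Symmetric L
    L-sym x y = trans (cong (λ m → a x * m * a y) (A-sym x y))
        (solve 3 (λ a m b → a :* m :* b := b :* m :* a) refl (a x) (A y x) (a y))

    module P = Polynomials L L-sym
    open P using (pow; poly)

    A-values : ∀ x y → A x y ≡ + 0 ⊎ (Adj x y × A x y ≡ + 1)
    A-values x y with adj? x y
    ... | yes f = inj₂ (f , refl)
    ... | no _ = inj₁ refl

    A-nonneg : ∀ x y → + 0 ≤ A x y
    A-nonneg x y with adj? x y
    ... | yes _ = +≤+ z≤n
    ... | no _ = +≤+ z≤n

    A-idem : ∀ x y → A x y * A x y ≡ A x y
    A-idem x y with adj? x y
    ... | yes _ = *-identityˡ (+ 1)
    ... | no _ = zeroˡ (+ 0)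

    Supported : Function → Set
    Supported f = ∀ x → a x * f x ≡ f x

    a-supported : Supported a
    a-supported = A-idem v

    L-supported : ∀ f → Supported (L · f)
    L-supported f x = trans (*-distribˡ-sum (a x) (λ y → L x y * f y)) (sum-cong-≗ (λ y →
      trans (solve 4 (λ a m b f → a :* (a :* m :* b :* f) := (a :* a) :* m :* b :* f) refl (a x)
          (A x y) (a y) (f y)) (cong (λ c → c * A x y * a y * f y) (A-idem v x))))

    sum-a : sum a ≡ + 32
    sum-a = sum-A v

    ip-a : ∀ {f} → Supported f → ⟨ a , f ⟩ ≡ sum f
    ip-a s = sum-cong-≗ s

    -- The local graph is regular of valency a₁ = 4.
    L-a : ∀ x → (L · a) x ≡ + 4 * a x
    L-a x = trans (sum-cong-≗ (λ y → trans
        (solve 3 (λ a m b → a :* m :* b :* b := a :* (m :* (b :* b))) refl (a x) (A x y) (a y))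
        (cong (λ z → a x * (A x y * z)) (trans (A-idem v y) (a-unit y)))))
      (trans (sym (*-distribˡ-sum (a x) (λ y → A x y * unit 1 (d v y))))
      (trans (cong (a x *_) (sum-neighbours (unit 1) v x)) (on-support (A-values v x))))
      where
      a-unit : ∀ y → a y ≡ unit 1 (d v y)
      a-unit y = 𝟙-cong (adj? v y) (d v y ℕ.≟ 1) Adj⇒d≡1 d≡1⇒Adj
      on-support : a x ≡ + 0 ⊎ (Adj v x × a x ≡ + 1) → a x * tridiagonal (unit 1) (d v x) ≡ + 4 * a
          x
      on-support (inj₁ e) = trans (cong₂ _*_ e refl)
          (trans (zeroˡ _) (sym (trans (cong (+ 4 *_) e) (zeroʳ _))))
      on-support (inj₂ (f , e)) = trans (cong₂ (λ s t → s * tridiagonal (unit 1) t) e (Adj⇒d≡1 f))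
        (trans (solve 0 (κ 1 :* (κ 0 :+ κ 4 :* κ 1 :+ κ 27 :* κ 0) := κ 4 :* κ 1) refl)
            (cong (+ 4 *_) (sym e)))

    local-distance : ∀ {x y} → Adj v x → Adj v y → d x y ℕ.≤ 2
    local-distance f g = d-≤-walk (cons (Adj-sym f) (cons g nil))

    -- Two neighbours of v are at distance at most 2, so on them every radial kernel is a
    -- combination of the identity, the all-ones matrix and `L`.
    local-radial : ∀ (k : ℕ → ℤ) (x y : V) → a x * k (d x y) * a y ≡ (k 0 - k 2) * (δ x y * a x) + k
        2 * (a x * a y) + (k 1 - k 2) * L x y
    local-radial k x y with A-values v x | A-values v y
    ... | inj₁ e | _ = subst (λ s → s * k (d x y) * a y ≡ (k 0 - k 2) * (δ x y * s) + k 2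
        * (s * a y) + (k 1 - k 2) * (s * A x y * a y)) (sym e)
      (solve 7 (λ p q r k b c m → κ 0 :* k :* b := p :* (c :* κ 0) :+ q :* (κ 0 :* b) :+ r
          :* (κ 0 :* m :* b)) refl (k 0 - k 2) (k 2) (k 1 - k 2) (k (d x y)) (a y) (δ x y) (A x y))
    ... | inj₂ (f , e) | inj₁ e′ = trans (trans (cong (a x * k (d x y) *_) e′) (zeroʳ _))
        (sym (trans (cong₂ (λ s t → (k 0 - k 2) * s + k 2 * (a x * t) + (k 1 - k 2)
        * (a x * A x y * t)) x≢y e′)
        (solve 5 (λ p q r a m → p :* κ 0 :+ q :* (a :* κ 0) :+ r :* (a :* m :* κ 0) := κ 0) refl
            (k 0 - k 2) (k 2) (k 1 - k 2) (a x) (A x y))))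
      where
      x≢y : δ x y * a x ≡ + 0
      x≢y with x ≟ y
      ... | yes refl = trans (*-identityˡ _) e′
      ... | no _ = zeroˡ _
    ... | inj₂ (f , e) | inj₂ (f′ , e′) = subst₂
        (λ s t → s * k (d x y) * t ≡ (k 0 - k 2) * (δ x y * s) + k 2 * (s * t) + (k 1 - k 2)
        * (s * A x y * t)) (sym e) (sym e′) (by-distance (d x y) refl (local-distance f f′))
      where
      by-distance : ∀ j → d x y ≡ j → j ℕ.≤ 2 → + 1 * k (d x y) * + 1 ≡ (k 0 - k 2) * (δ x y * + 1)
          + k 2 * (+ 1 * + 1) + (k 1 - k 2) * (+ 1 * A x y * + 1)
      reduce : ∀ {j s t} → d x y ≡ j → δ x y ≡ s → A x y ≡ t →
        + 1 * k j * + 1 ≡ (k 0 - k 2) * (s * + 1) + k 2 * (+ 1 * + 1) + (k 1 - k 2)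
            * (+ 1 * t * + 1) →
        + 1 * k (d x y) * + 1 ≡ (k 0 - k 2) * (δ x y * + 1) + k 2 * (+ 1 * + 1) + (k 1 - k 2)
            * (+ 1 * A x y * + 1)
      reduce refl refl refl h = h
      by-distance 0 q _ = reduce q (𝟙-yes (x ≟ y) (d≡0⇒≡ q))
          (𝟙-no (adj? x y) (λ h → ℕₚ.0≢1+n (trans (sym q) (Adj⇒d≡1 h))))
        (solve 3 (λ p q r → κ 1 :* p :* κ 1 := (p :- r) :* (κ 1 :* κ 1) :+ r :* (κ 1 :* κ 1)
            :+ (q :- r) :* (κ 1 :* κ 0 :* κ 1)) refl (k 0) (k 1) (k 2))
      by-distance 1 q _ = reduce q (𝟙-no (x ≟ y) (λ { refl → ℕₚ.0≢1+n (trans (sym (d-refl x)) q) }))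
          (𝟙-yes (adj? x y) (d≡1⇒Adj q))
        (solve 3 (λ p q r → κ 1 :* q :* κ 1 := (p :- r) :* (κ 0 :* κ 1) :+ r :* (κ 1 :* κ 1)
            :+ (q :- r) :* (κ 1 :* κ 1 :* κ 1)) refl (k 0) (k 1) (k 2))
      by-distance 2 q _ = reduce q (𝟙-no (x ≟ y) (λ { refl → ℕₚ.0≢1+n (trans (sym (d-refl x)) q) }))
          (𝟙-no (adj? x y) (λ h → ℕₚ.0≢1+n (ℕₚ.suc-injective (trans (sym (Adj⇒d≡1 h)) q))))
        (solve 3 (λ p q r → κ 1 :* r :* κ 1 := (p :- r) :* (κ 0 :* κ 1) :+ r :* (κ 1 :* κ 1)
            :+ (q :- r) :* (κ 1 :* κ 0 :* κ 1)) refl (k 0) (k 1) (k 2))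
      by-distance (suc (suc (suc _))) _ (s≤s (s≤s ()))

    radial-local : ∀ (k : ℕ → ℤ) {f} → Supported f → ∀ x → a x * (radial k · f) x ≡ (k 0 - k 2) * f
        x + k 2 * (sum f * a x) + (k 1 - k 2) * (L · f) x
    radial-local k {f} s x = trans (*-distribˡ-sum (a x) (λ y → k (d x y) * f y))
      (trans (sum-cong-≗ (λ y → trans (cong (λ z → a x * (k (d x y) * z)) (sym (s y)))
        (trans (solve 4 (λ a k b f → a :* (k :* (b :* f)) := (a :* k :* b) :* f) refl (a x)
            (k (d x y)) (a y) (f y))
        (trans (cong (_* f y) (local-radial k x y))
        (trans (solve 8 (λ p q r a δ b l f → (p :* (δ :* a) :+ q :* (a :* b) :+ r :* l) :* f := p
            :* (δ :* (a :* f)) :+ q :* ((b :* f) :* a) :+ r :* (l :* f))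
           refl (k 0 - k 2) (k 2) (k 1 - k 2) (a x) (δ x y) (a y) (L x y) (f y))
          (cong (λ z → (k 0 - k 2) * (δ x y * (a x * f y)) + k 2 * (z * a x) + (k 1 - k 2)
              * (L x y * f y)) (s y)))))))
      (trans (sum-linear₃ (k 0 - k 2) (k 2) (k 1 - k 2) (λ y → δ x y * (a x * f y))
          (λ y → f y * a x) (λ y → L x y * f y))
      (cong₂ (λ s t → (k 0 - k 2) * s + k 2 * t + (k 1 - k 2) * (L · f) x)
          (trans (sum-δ x (λ y → a x * f y)) (s x)) (sym (*-distribʳ-sum (a x) f)))))

    E-local : ∀ {f} → Supported f → ∀ x → a x * (E · f) x ≡ + 14 * f x + + 2 * (sum f * a x) - + 7
        * (L · f) x
    E-local {f} s x = trans (radial-local e s x)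
        (solve 3 (λ f s l → (κ 16 :- κ 2) :* f :+ κ 2 :* s :+ (con (ℤ.- + 5) :- κ 2) :* l := κ 14
        :* f :+ κ 2 :* s :- κ 7 :* l) refl (f x) (sum f * a x) ((L · f) x))

    -- As `g 2` is 0, no all-ones term appears. Between neighbours of v the matrix is 3 (4 + L),
    -- whose kernel there is the eigenspace of -4.
    Γ-local : ∀ {f} → Supported f → ∀ x → a x * (Γ · f) x ≡ + 12 * f x + + 3 * (L · f) x
    Γ-local {f} s x = trans (radial-local g s x)
        (solve 3 (λ f s l → (κ 12 :- κ 0) :* f :+ κ 0 :* s :+ (κ 3 :- κ 0) :* l := κ 12 :* f :+ κ 3
        :* l) refl (f x) (sum f * a x) ((L · f) x))

    ip-E-local : ∀ {f h} → Supported h → Supported f → ⟨ h , E · f ⟩ ≡ + 14 * ⟨ h , f ⟩ + + 2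
        * (sum f * sum h) - + 7 * ⟨ h , L · f ⟩
    ip-E-local {f} {h} s′ s = trans (sum-cong-≗ (λ x → trans (cong (_* (E · f) x) (sym (s′ x)))
        (trans (solve 3 (λ a h e → a :* h :* e := h :* (a :* e)) refl (a x) (h x) ((E · f) x))
            (trans (cong (h x *_) (E-local s x))
        (solve 5 (λ h f s a l → h :* (κ 14 :* f :+ κ 2 :* (s :* a) :- κ 7 :* l) := κ 14 :* (h :* f)
            :+ (κ 2 :* s) :* (a :* h) :+ con (ℤ.- + 7) :* (h :* l)) refl (h x) (f x) (sum f) (a x)
            ((L · f) x))))))
      (trans (sum-linear₃ (+ 14) (+ 2 * sum f) (ℤ.- + 7) (λ x → h x * f x) (λ x → a x * h x)
          (λ x → h x * (L · f) x))
      (trans (cong (λ z → + 14 * ⟨ h , f ⟩ + + 2 * sum f * z + (ℤ.- + 7) * ⟨ h , L · f ⟩) (ip-a s′))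
        (solve 4 (λ i s t j → κ 14 :* i :+ κ 2 :* s :* t :+ con (ℤ.- + 7) :* j := κ 14 :* i :+ κ 2
            :* (s :* t) :- κ 7 :* j) refl ⟨ h , f ⟩ (sum f) (sum h) ⟨ h , L · f ⟩)))

    E-to-centre : ∀ x → a x * E x v ≡ (ℤ.- + 5) * a x
    E-to-centre x with A-values v x
    ... | inj₁ h = trans (cong (_* E x v) h)
        (trans (zeroˡ _) (sym (trans (cong ((ℤ.- + 5) *_) h) (zeroʳ _))))
    ... | inj₂ (h , h′) = trans (cong₂ (λ s t → s * e t) h′ (trans (d-sym x v) (Adj⇒d≡1 h)))
        (trans (*-comm _ _) (cong ((ℤ.- + 5) *_) (sym h′)))

    E-centre : ∀ {f} → Supported f → (E · f) v ≡ (ℤ.- + 5) * sum f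
    E-centre {f} s = trans (sum-cong-≗
        (λ y → trans (cong (E v y *_) (sym (s y)))
        (trans (solve 3 (λ e a f → e :* (a :* f) := (a :* e) :* f) refl (E v y) (a y) (f y))
        (trans (cong (_* f y) (trans (cong (a y *_) (radial-sym e v y)) (E-to-centre y)))
            (trans (*-assoc _ _ _) (cong ((ℤ.- + 5) *_) (s y)))))))
      (sym (*-distribˡ-sum (ℤ.- + 5) f))

    E-self : ∀ u → E u u ≡ + 16
    E-self u = cong e (d-refl u)

    -- The Gram form of f plus the multiple of the base vertex that makes it
    -- orthogonal to that vertex.
    module _ {f : Function} (s : Supported f) where
      private
        S = sum f
        F = linear₃ (+ 16) (+ 5 * S) (+ 0) f (δ v) f

        EF : ∀ x → (E · F) x ≡ + 16 * (E · f) x + + 5 * S * E x v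
        EF x = trans (·-linear E (+ 16) (+ 5 * S) (+ 0) f (δ v) f x)
          (trans (cong (λ z → + 16 * (E · f) x + + 5 * S * z + + 0 * (E · f) x) (·-δ E v x))
            (solve 3 (λ p s q → κ 16 :* p :+ κ 5 :* s :* q :+ κ 0 :* p := κ 16 :* p :+ κ 5 :* s
                :* q) refl ((E · f) x) S (E x v)))

        EF-centre : (E · F) v ≡ + 0
        EF-centre = trans (EF v) (trans
            (cong₂ (λ p q → + 16 * p + + 5 * S * q) (E-centre s) (E-self v))
          (solve 1 (λ s → κ 16 :* (con (ℤ.- + 5) :* s) :+ κ 5 :* s :* κ 16 := κ 0) refl S))

        form : ⟨ F , E · F ⟩ ≡ + 112 * (+ 16 * (+ 2 * ⟨ f , f ⟩ - ⟨ f , L · f ⟩) + S * S)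
        form = trans (ip-linearˡ (+ 16) (+ 5 * S) (+ 0) f (δ v) f (E · F))
          (trans (cong₂ (λ p q → + 16 * p + + 5 * S * q + + 0 * p) ip-f-EF
              (trans (ip-δ v (E · F)) EF-centre))
            (solve 3 (λ p q s → κ 16 :* (κ 16 :* (κ 14 :* p :+ κ 2 :* (s :* s) :- κ 7 :* q) :+ κ 5
                :* s :* (con (ℤ.- + 5) :* s)) :+ κ 5 :* s :* κ 0
                :+ κ 0 :* (κ 16 :* (κ 14 :* p :+ κ 2 :* (s :* s) :- κ 7 :* q) :+ κ 5 :* s
                    :* (con (ℤ.- + 5) :* s))
              := κ 112 :* (κ 16 :* (κ 2 :* p :- q) :+ s :* s)) refl ⟨ f , f ⟩ ⟨ f , L · f ⟩ S))
          where
          ip-f-EF : ⟨ f , E · F ⟩ ≡ + 16 * (+ 14 * ⟨ f , f ⟩ + + 2 * (S * S) - + 7 * ⟨ f , L · f ⟩)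
              + + 5 * S * ((ℤ.- + 5) * S)
          ip-f-EF = trans (ip-congʳ f (λ x → trans (EF x)
              (solve 3 (λ p q r → p :+ q :* r := p :+ q :* r :+ κ 0 :* r) refl (+ 16 * (E · f) x)
              (+ 5 * S) (E x v))))
            (trans (ip-linearʳ (+ 16) (+ 5 * S) (+ 0) (E · f) (λ x → E x v) (λ x → E x v) f)
            (trans (cong₂ (λ p q → + 16 * p + + 5 * S * q + + 0 * q) (ip-E-local s s)
                (trans (ip-comm f _) (trans (ip-congˡ f (λ x → radial-sym e x v)) (E-centre s))))
              (solve 3 (λ p q s → p :+ q :* s :+ κ 0 :* s := p :+ q :* s) refl
                  (+ 16 * (+ 14 * ⟨ f , f ⟩ + + 2 * (S * S) - + 7 * ⟨ f , L · f ⟩)) (+ 5 * S)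
                  ((ℤ.- + 5) * S))))

      -- For functions of sum 0 this bounds the eigenvalues of `L` by 2. At `a` the form vanishes,
      -- since 16 (2 - 4) + 32 = 0: in the eigenspace the neighbours of v add up to -10 times v.
      local-nonneg : + 0 ≤ + 16 * (+ 2 * ⟨ f , f ⟩ - ⟨ f , L · f ⟩) + sum f * sum f
      local-nonneg = *-nonneg-cancelˡ 111
          (subst (+ 0 ≤_) form (form-nonneg (radial-sym e) 335 E-square F))

      local-zero : + 16 * (+ 2 * ⟨ f , f ⟩ - ⟨ f , L · f ⟩) + sum f * sum f ≡ + 0 →
        ∀ x → + 16 * (+ 2 * f x - (L · f) x) + sum f * a x ≡ + 0
      local-zero h x = *-cancelˡ 6 (trans
        (trans (solve 4 (λ f l s a → κ 7 :* (κ 16 :* (κ 2 :* f :- l) :+ s :* a) := κ 16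
            :* (κ 14 :* f :+ κ 2 :* (s :* a) :- κ 7 :* l) :+ κ 5 :* s :* (con (ℤ.- + 5) :* a)) refl
            (f x) ((L · f) x) S (a x))
        (trans (cong₂ (λ p q → + 16 * p + + 5 * S * q) (sym (E-local s x)) (sym (E-to-centre x)))
        (trans (solve 4 (λ a p s q → κ 16 :* (a :* p) :+ κ 5 :* s :* (a :* q) := a
            :* (κ 16 :* p :+ κ 5 :* s :* q)) refl (a x) ((E · f) x) S (E x v))
        (trans (cong (a x *_) (trans (sym (EF x))
            (form-zero (radial-sym e) 335 E-square F
            (trans form (trans (cong (+ 112 *_) h) (zeroʳ _))) x))) (zeroʳ _)))))
        (sym (zeroʳ (+ 7))))

    poly-supported : ∀ p {f} → Supported f → Supported (poly p f)
    poly-supported [] s x = zeroʳ (a x)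
    poly-supported (b ∷ p) {f} s x = trans
        (solve 4 (λ a b f l → a :* (b :* f :+ l) := b :* (a :* f) :+ a :* l) refl (a x) b (f x)
        ((L · poly p f) x))
      (cong₂ (λ s t → b * s + t) (s x) (L-supported (poly p f) x))

    L-poly : ∀ p f → L · poly p f ≗ poly (+ 0 ∷ p) f
    L-poly p f x = sym (trans (cong (_+ (L · poly p f) x) (zeroˡ (f x))) (+-identityˡ _))

    sum-poly : ∀ p {f} → Supported f → sum (poly p f) ≡ horner (+ 4) p * sum f
    sum-poly p {f} s = trans (sym (ip-a (poly-supported p s))) (trans (P.poly-adjoint p a f)
      (trans (ip-congˡ f (P.poly-eigen p L-a))
          (trans (ip-scaleˡ (horner (+ 4) p) a f) (cong (horner (+ 4) p *_) (ip-a s)))))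

    ip-poly-L : ∀ p q f → ⟨ poly p f , L · poly q f ⟩ ≡ moment (p ⊗ (+ 0 ∷ q))
        (λ k → ⟨ f , pow k f ⟩)
    ip-poly-L p q f = trans (ip-congʳ (poly p f) (L-poly q f)) (P.ip-poly-poly p (+ 0 ∷ q) f)

    linear-poly : ∀ b f x → poly (b ∷ + 1 ∷ []) f x ≡ b * f x + (L · f) x
    linear-poly b f x = cong (λ z → b * f x + z)
        (·-cong L (λ t → trans (cong₂ _+_ (*-identityˡ (f t)) (P.·-0 t)) (+-identityʳ _)) x)

    -- Short cycles and closed walks in the local graph

    sum-L : ∀ {f} → Supported f → sum (L · f) ≡ + 4 * sum f
    sum-L {f} s = trans (sym (ip-a (L-supported f)))
        (trans (·-adjoint L-sym a f) (trans (ip-congˡ f L-a)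
        (trans (ip-scaleˡ (+ 4) a f) (cong (+ 4 *_) (ip-a s)))))

    L-nonneg : ∀ x y → + 0 ≤ L x y
    L-nonneg x y = *-nonneg (*-nonneg (A-nonneg v x) (A-nonneg x y)) (A-nonneg v y)

    L·-nonneg : ∀ {f} → (∀ x → + 0 ≤ f x) → ∀ x → + 0 ≤ (L · f) x
    L·-nonneg h x = sum-nonneg (λ y → *-nonneg (L-nonneg x y) (h y))

    -- The local form at (L + 2) c: the excess o = L c − 2 c is a nonnegative
    -- integral function of total 2 m, whence ⟨ o , o ⟩ ≥ 2 m.
    short-cycle-bound : ∀ {c m} → Supported c → (∀ x → + 0 ≤ c x) → (∀ x → c x * c x ≡ c x) →
      (∀ x → + 0 ≤ (L · c) x - + 2 * c x) → sum c ≡ m → + 0 ≤ + 36 * (m * m) - + 192 * m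
    short-cycle-bound {c} {m} s c≥0 idem o≥0 total = subst (+ 0 ≤_) combine
        (+-nonneg (local-nonneg (poly-supported (+ 2 ∷ + 1 ∷ []) s)) (*-nonneg {+ 16} (+≤+ z≤n)
        (+-nonneg (+-nonneg (*-nonneg {+ 16} (+≤+ z≤n) (ip-nonneg c≥0 o≥0′))
            (*-nonneg {+ 6} (+≤+ z≤n) excess)) (ip-nonneg o≥0′ (L·-nonneg o≥0′)))))
      where
      o : Function
      o = poly ((ℤ.- + 2) ∷ + 1 ∷ []) c
      y : ℕ → ℤ
      y k = ⟨ c , pow k c ⟩
      o≥0′ : ∀ x → + 0 ≤ o x
      o≥0′ x = subst (+ 0 ≤_) (trans (solve 2 (λ l c → l :- κ 2 :* c := con (ℤ.- + 2) :* c :+ l)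
          refl ((L · c) x) (c x)) (sym (linear-poly (ℤ.- + 2) c x))) (o≥0 x)
      ip-nonneg : ∀ {f g} → (∀ x → + 0 ≤ f x) → (∀ x → + 0 ≤ g x) → + 0 ≤ ⟨ f , g ⟩
      ip-nonneg p q = sum-nonneg (λ x → *-nonneg (p x) (q x))
      excess : + 0 ≤ ⟨ o , o ⟩ - sum o
      excess = subst (+ 0 ≤_) (trans (sum-cong-≗
          (λ x → solve 1 (λ o → o :* o :- o := κ 1 :* (o :* o) :+ con (ℤ.- + 1) :* o :+ κ 0 :* o)
          refl (o x)))
          (trans (sum-linear₃ (+ 1) (ℤ.- + 1) (+ 0) (λ x → o x * o x) o o)
              (solve 2 (λ i s → κ 1 :* i :+ con (ℤ.- + 1) :* s :+ κ 0 :* s := i :- s) refl ⟨ o , o ⟩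
              (sum o))))
        (sum-nonneg (λ x → ≤⇒0≤- (≤-square (o≥0′ x))))
      ip-c-o : ⟨ c , o ⟩ ≡ moment ((ℤ.- + 2) ∷ + 1 ∷ []) y
      ip-c-o = P.ip-poly ((ℤ.- + 2) ∷ + 1 ∷ []) c c
      y₀ : y 0 ≡ m
      y₀ = trans (sum-cong-≗ idem) total
      combine : + 16 * (+ 2 * ⟨ poly (+ 2 ∷ + 1 ∷ []) c , poly (+ 2 ∷ + 1 ∷ []) c ⟩
          - ⟨ poly (+ 2 ∷ + 1 ∷ []) c , L · poly (+ 2 ∷ + 1 ∷ []) c ⟩)
          + sum (poly (+ 2 ∷ + 1 ∷ []) c) * sum (poly (+ 2 ∷ + 1 ∷ []) c)
          + + 16 * (+ 16 * ⟨ c , o ⟩ + + 6 * (⟨ o , o ⟩ - sum o) + ⟨ o , L · o ⟩)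
        ≡ + 36 * (m * m) - + 192 * m
      combine = evaluate (P.ip-poly-poly (+ 2 ∷ + 1 ∷ []) (+ 2 ∷ + 1 ∷ []) c)
          (ip-poly-L (+ 2 ∷ + 1 ∷ []) (+ 2 ∷ + 1 ∷ []) c) (sum-poly (+ 2 ∷ + 1 ∷ []) s)
        ip-c-o (P.ip-poly-poly ((ℤ.- + 2) ∷ + 1 ∷ []) ((ℤ.- + 2) ∷ + 1 ∷ []) c)
            (sum-poly ((ℤ.- + 2) ∷ + 1 ∷ []) s)
        (ip-poly-L ((ℤ.- + 2) ∷ + 1 ∷ []) ((ℤ.- + 2) ∷ + 1 ∷ []) c) y₀ total
        where
        evaluate : ∀ {y₀ y₁ y₂ y₃ t i j k l p q r} → i ≡ + 4 * y₀ + (+ 4 * y₁ + (+ 1 * y₂ + + 0))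
            → j ≡ + 0 * y₀ + (+ 4 * y₁ + (+ 4 * y₂ + (+ 1 * y₃ + + 0))) → k ≡ + 6 * t →
          l ≡ (ℤ.- + 2) * y₀ + (+ 1 * y₁ + + 0) → p ≡ + 4 * y₀ + ((ℤ.- + 4) * y₁ + (+ 1 * y₂ + + 0))
              → q ≡ + 2 * t →
          r ≡ + 0 * y₀ + (+ 4 * y₁ + ((ℤ.- + 4) * y₂ + (+ 1 * y₃ + + 0))) → y₀ ≡ m → t ≡ m →
          + 16 * (+ 2 * i - j) + k * k + + 16 * (+ 16 * l + + 6 * (p - q) + r) ≡ + 36 * (m * m)
              - + 192 * m
        evaluate {y₁ = y₁} {y₂} {y₃} refl refl refl refl refl refl refl refl refl = solve 4
            (λ m y₁ y₂ y₃ →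
            κ 16 :* (κ 2 :* (κ 4 :* m :+ (κ 4 :* y₁ :+ (κ 1 :* y₂ :+ κ 0)))
                :- (κ 0 :* m :+ (κ 4 :* y₁ :+ (κ 4 :* y₂ :+ (κ 1 :* y₃ :+ κ 0)))))
            :+ (κ 6 :* m) :* (κ 6 :* m)
            :+ κ 16 :* (κ 16 :* (con (ℤ.- + 2) :* m :+ (κ 1 :* y₁ :+ κ 0)) :+ κ 6
                :* ((κ 4 :* m :+ (con (ℤ.- + 4) :* y₁ :+ (κ 1 :* y₂ :+ κ 0))) :- κ 2 :* m)
                 :+ (κ 0 :* m :+ (κ 4 :* y₁ :+ (con (ℤ.- + 4) :* y₂ :+ (κ 1 :* y₃ :+ κ 0)))))
            := κ 36 :* (m :* m) :- κ 192 :* m) refl _ y₁ y₂ y₃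

    L-values : ∀ x y → L x y ≡ + 0 ⊎ (Adj v x × Adj x y × Adj v y × L x y ≡ + 1)
    L-values x y with A-values v x | A-values x y | A-values v y
    ... | inj₁ p | _ | _ = inj₁ (trans (cong (λ z → z * A x y * a y) p)
        (solve 2 (λ b c → κ 0 :* b :* c := κ 0) refl (A x y) (a y)))
    ... | inj₂ _ | inj₁ p | _ = inj₁
        (trans (cong (λ z → a x * z * a y) p)
        (solve 2 (λ b c → b :* κ 0 :* c := κ 0) refl (a x) (a y)))
    ... | inj₂ _ | inj₂ _ | inj₁ p = inj₁ (trans (cong (a x * A x y *_) p) (zeroʳ _))
    ... | inj₂ (f , p) | inj₂ (h , q) | inj₂ (f′ , r) = inj₂
        (f , h , f′ , trans (cong₂ _*_ (cong₂ _*_ p q) r) (solve 0 (κ 1 :* κ 1 :* κ 1 := κ 1) refl))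

    LocallyAdjacent : V → V → Set
    LocallyAdjacent x y = L x y ≡ + 1

    local-adj : ∀ {x y} → ¬ L x y ≡ + 0 → LocallyAdjacent x y
    local-adj {x} {y} h with L-values x y
    ... | inj₁ p = ⊥-elim (h p)
    ... | inj₂ (_ , _ , _ , p) = p

    local-members : ∀ {x y} → LocallyAdjacent x y → Adj v x × Adj x y × Adj v y
    local-members {x} {y} h with L-values x y
    ... | inj₁ p with () ← trans (sym h) p
    ... | inj₂ (f , g , f′ , _) = f , g , f′

    local-sym : ∀ {x y} → LocallyAdjacent x y → LocallyAdjacent y x
    local-sym {x} {y} h = trans (L-sym y x) h

    local-≢ : ∀ {x y} → LocallyAdjacent x y → ¬ x ≡ y
    local-≢ h refl = irrefl (proj₁ (proj₂ (local-members h)))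

    record TwoNeighbours (xs : List V) (t : V) : Set where
      constructor two
      field
        {p q} : V
        p∈ : p ∈ xs
        q∈ : q ∈ xs
        adj-p : LocallyAdjacent t p
        adj-q : LocallyAdjacent t q
        p≢q : ¬ p ≡ q

    -- The quantity 36 m² - 192 m is negative for m from 1 to 5. Asking for two neighbours within
    -- the list, and not for an induced cycle, spares any discussion of chords.
    no-short-cycle : ∀ xs → Unique xs → All (TwoNeighbours xs) xs → + 0 ≤ + 36
        * (+ length xs * + length xs) - + 192 * + length xs
    no-short-cycle xs U cyc = short-cycle-bound c-supported c≥0 c-idem o≥0 (sum-multiplicity xs)
      where
      c = multiplicity xs
      c-values : ∀ t → (t ∈ xs × c t ≡ + 1) ⊎ c t ≡ + 0
      c-values t with t ∈? xs
      ... | yes m = inj₁ (m , multiplicity-∈ U m)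
      ... | no ¬m = inj₂ (multiplicity-∉ xs ¬m)
      c-supported : Supported c
      c-supported t with c-values t
      ... | inj₁ (m , _) = trans (cong (_* c t)
          (𝟙-yes (adj? v t) (proj₁ (local-members (TwoNeighbours.adj-p (All.lookup cyc m))))))
          (*-identityˡ _)
      ... | inj₂ p = trans (cong (a t *_) p) (trans (zeroʳ _) (sym p))
      c≥0 : ∀ t → + 0 ≤ c t
      c≥0 t with c-values t
      ... | inj₁ (_ , p) = subst (+ 0 ≤_) (sym p) (+≤+ z≤n)
      ... | inj₂ p = subst (+ 0 ≤_) (sym p) (+≤+ z≤n)
      c-idem : ∀ t → c t * c t ≡ c t
      c-idem t with c-values t
      ... | inj₁ (_ , p) = trans (cong (_* c t) p) (*-identityˡ _)
      ... | inj₂ p = trans (cong (_* c t) p) (trans (zeroˡ _) (sym p))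
      o≥0 : ∀ t → + 0 ≤ (L · c) t - + 2 * c t
      o≥0 t with c-values t
      ... | inj₂ p = subst (+ 0 ≤_) (trans (solve 1 (λ l → l := l :- κ 2 :* κ 0) refl ((L · c) t))
          (cong (λ z → (L · c) t - + 2 * z) (sym p))) (L·-nonneg c≥0 t)
      ... | inj₁ (m , e) with All.lookup cyc m
      ... | two {p} {q} p∈ q∈ t~p t~q p≢q = subst (+ 0 ≤_) total (sum-nonneg pointwise)
        where
        pointwise : ∀ u → + 0 ≤ + 1 * (L t u * c u) + (ℤ.- + 1) * δ p u + (ℤ.- + 1) * δ q u
        pointwise u with p ≟ u | q ≟ u
        ... | yes refl | yes r = ⊥-elim (p≢q (sym r))
        ... | yes refl | no _ = subst (+ 0 ≤_)
            (trans (solve 0 (κ 0 := κ 1 :* (κ 1 :* κ 1) :+ con (ℤ.- + 1) :* κ 1 :+ con (ℤ.- + 1)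
            :* κ 0) refl)
            (cong₂ (λ s t → + 1 * (s * t) + (ℤ.- + 1) * + 1 + (ℤ.- + 1) * + 0) (sym t~p)
                (sym (multiplicity-∈ U p∈)))) (+≤+ z≤n)
        ... | no _ | yes refl = subst (+ 0 ≤_)
            (trans (solve 0 (κ 0 := κ 1 :* (κ 1 :* κ 1) :+ con (ℤ.- + 1) :* κ 0 :+ con (ℤ.- + 1)
            :* κ 1) refl)
            (cong₂ (λ s t → + 1 * (s * t) + (ℤ.- + 1) * + 0 + (ℤ.- + 1) * + 1) (sym t~q)
                (sym (multiplicity-∈ U q∈)))) (+≤+ z≤n)
        ... | no _ | no _ = subst (+ 0 ≤_)
            (solve 1 (λ l → l := κ 1 :* l :+ con (ℤ.- + 1) :* κ 0 :+ con (ℤ.- + 1) :* κ 0) refl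
            (L t u * c u)) (*-nonneg (L-nonneg t u) (c≥0 u))
        total : sum (λ u → + 1 * (L t u * c u) + (ℤ.- + 1) * δ p u + (ℤ.- + 1) * δ q u) ≡ (L · c) t
            - + 2 * c t
        total = trans (sum-linear₃ (+ 1) (ℤ.- + 1) (ℤ.- + 1) (λ u → L t u * c u) (δ p) (δ q))
          (trans (cong₂ (λ s r → + 1 * (L · c) t + (ℤ.- + 1) * s + (ℤ.- + 1) * r) (sum-δ-1 p)
              (sum-δ-1 q))
          (trans (solve 1 (λ l → κ 1 :* l :+ con (ℤ.- + 1) :* κ 1 :+ con (ℤ.- + 1) :* κ 1 := l
              :- κ 2 :* κ 1) refl ((L · c) t)) (cong (λ z → (L · c) t - + 2 * z) (sym e))))

    negative : ∀ {k x} → + 0 ≤ x → x ≡ -[1+ k ] → ⊥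
    negative () refl

    no-triangle : ∀ {x y z} → LocallyAdjacent x y → LocallyAdjacent y z → LocallyAdjacent z x → ⊥
    no-triangle {x} {y} {z} xy yz zx = negative (no-short-cycle (x ∷ y ∷ z ∷ [])
        ((local-≢ xy ∷ local-≢ (local-sym zx) ∷ []) ∷ (local-≢ yz ∷ []) ∷ [] ∷ [])
        (two (there (here refl)) (there (there (here refl))) xy (local-sym zx) (local-≢ yz)
        ∷ two (here refl) (there (there (here refl))) (local-sym xy) yz (local-≢ (local-sym zx))
        ∷ two (here refl) (there (here refl)) zx (local-sym yz) (local-≢ xy) ∷ []))
      (solve 0 (κ 36 :* (κ 3 :* κ 3) :- κ 192 :* κ 3 := con (ℤ.- + 252)) refl)

    no-quadrangle : ∀ {x y z w} → LocallyAdjacent x y → LocallyAdjacent y z → LocallyAdjacent z w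
        → LocallyAdjacent w x → ¬ x ≡ z → ¬ y ≡ w → ⊥
    no-quadrangle {x} {y} {z} {w} xy yz zw wx x≢z y≢w = negative
        (no-short-cycle (x ∷ y ∷ z ∷ w ∷ [])
        ((local-≢ xy ∷ x≢z ∷ local-≢ (local-sym wx) ∷ []) ∷ (local-≢ yz ∷ y≢w ∷ [])
            ∷ (local-≢ zw ∷ []) ∷ [] ∷ [])
        (two (there (here refl)) (there (there (there (here refl)))) xy (local-sym wx) y≢w
        ∷ two (here refl) (there (there (here refl))) (local-sym xy) yz x≢z
        ∷ two (there (here refl)) (there (there (there (here refl)))) (local-sym yz) zw y≢w
        ∷ two (here refl) (there (there (here refl))) wx (local-sym zw) x≢z ∷ []))
      (solve 0 (κ 36 :* (κ 4 :* κ 4) :- κ 192 :* κ 4 := con (ℤ.- + 192)) refl)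

    -- A closed 5-walk suffices as hypothesis: if two of its non-consecutive vertices coincide, a
    -- triangle remains.
    no-pentagon : ∀ {x y z w t} → LocallyAdjacent x y → LocallyAdjacent y z → LocallyAdjacent z w
        → LocallyAdjacent w t → LocallyAdjacent t x → ⊥
    no-pentagon {x} {y} {z} {w} {t} xy yz zw wt tx = negative
        (no-short-cycle (x ∷ y ∷ z ∷ w ∷ t ∷ [])
        ((local-≢ xy ∷ x≢z ∷ x≢w ∷ local-≢ (local-sym tx) ∷ []) ∷ (local-≢ yz ∷ y≢w ∷ y≢t ∷ [])
            ∷ (local-≢ zw ∷ z≢t ∷ []) ∷ (local-≢ wt ∷ []) ∷ [] ∷ [])
        (two (there (here refl)) (there (there (there (there (here refl))))) xy (local-sym tx) y≢t
        ∷ two (here refl) (there (there (here refl))) (local-sym xy) yz x≢z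
        ∷ two (there (here refl)) (there (there (there (here refl)))) (local-sym yz) zw y≢w
        ∷ two (there (there (here refl))) (there (there (there (there (here refl))))) (local-sym zw)
            wt z≢t
        ∷ two (here refl) (there (there (there (here refl)))) tx (local-sym wt) x≢w ∷ []))
      (solve 0 (κ 36 :* (κ 5 :* κ 5) :- κ 192 :* κ 5 := con (ℤ.- + 60)) refl)
      where
      x≢z : ¬ x ≡ z
      x≢z refl = no-triangle zw wt tx
      x≢w : ¬ x ≡ w
      x≢w refl = no-triangle xy yz zw
      y≢w : ¬ y ≡ w
      y≢w refl = no-triangle wt tx xy
      y≢t : ¬ y ≡ t
      y≢t refl = no-triangle yz zw wt
      z≢t : ¬ z ≡ t
      z≢t refl = no-triangle xy yz tx

    -- Closed walks of length at most five in the local graph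

    module Root {r : V} (r∈ : a r ≡ + 1) where

      closed : ℕ → ℤ
      closed k = ⟨ δ r , pow k (δ r) ⟩

      ℓ₁ ℓ₂ : Function
      ℓ₁ = L · δ r
      ℓ₂ = L · ℓ₁

      ℓ₁≗ : ∀ x → ℓ₁ x ≡ L x r
      ℓ₁≗ = ·-δ L r

      ℓ₁-values : ∀ x → ℓ₁ x ≡ + 0 ⊎ (LocallyAdjacent x r × ℓ₁ x ≡ + 1)
      ℓ₁-values x with L-values x r
      ... | inj₁ p = inj₁ (trans (ℓ₁≗ x) p)
      ... | inj₂ (_ , _ , _ , p) = inj₂ (p , trans (ℓ₁≗ x) p)

      L-δ-support : ∀ {x y} → ¬ L x y * ℓ₁ y ≡ + 0 → LocallyAdjacent x y × LocallyAdjacent y r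
      L-δ-support {x} {y} h with ℓ₁-values y | L-values x y
      ... | inj₁ p | _ = ⊥-elim (h (trans (cong (L x y *_) p) (zeroʳ _)))
      ... | inj₂ _ | inj₁ q = ⊥-elim (h (trans (cong (_* ℓ₁ y) q) (zeroˡ _)))
      ... | inj₂ (p , _) | inj₂ (_ , _ , _ , q) = q , p

      ℓ₂-support : ∀ {x} → ¬ ℓ₂ x ≡ + 0 → ∃ λ y → LocallyAdjacent x y × LocallyAdjacent y r
      ℓ₂-support h with sum-nonzero h
      ... | y , q = y , L-δ-support q

      δ-supported : Supported (δ r)
      δ-supported x with r ≟ x
      ... | yes refl = trans (*-comm (a r) (+ 1)) (trans (*-identityˡ _) r∈)
      ... | no _ = zeroʳ (a x)

      sum-δr : sum (δ r) ≡ + 1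
      sum-δr = trans (sym (ip-a δ-supported)) (trans (ip-δʳ a r) r∈)

      sum-ℓ₁ : sum ℓ₁ ≡ + 4
      sum-ℓ₁ = trans (sum-L δ-supported)
          (trans (cong (+ 4 *_) sum-δr) (solve 0 (κ 4 :* κ 1 := κ 4) refl))

      sum-ℓ₂ : sum ℓ₂ ≡ + 16
      sum-ℓ₂ = trans (sum-L (L-supported (δ r)))
          (trans (cong (+ 4 *_) sum-ℓ₁) (solve 0 (κ 4 :* κ 4 := κ 16) refl))

      closed₀ : closed 0 ≡ + 1
      closed₀ = trans (ip-δ r (δ r)) (𝟙-yes (r ≟ r) refl)

      closed₁ : closed 1 ≡ + 0
      closed₁ = trans (ip-δ r ℓ₁) (trans (ℓ₁≗ r) loopless)
        where
        loopless : L r r ≡ + 0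
        loopless with L-values r r
        ... | inj₁ p = p
        ... | inj₂ (_ , f , _) = ⊥-elim (irrefl f)

      ℓ₁-idem : ∀ x → ℓ₁ x * ℓ₁ x ≡ ℓ₁ x
      ℓ₁-idem x with ℓ₁-values x
      ... | inj₁ p = trans (cong (_* ℓ₁ x) p) (trans (zeroˡ _) (sym p))
      ... | inj₂ (_ , p) = trans (cong (_* ℓ₁ x) p) (*-identityˡ _)

      closed₂ : closed 2 ≡ + 4
      closed₂ = trans (·-adjoint L-sym (δ r) ℓ₁) (trans (sum-cong-≗ ℓ₁-idem) sum-ℓ₁)

      closed₃ : closed 3 ≡ + 0
      closed₃ = trans (·-adjoint L-sym (δ r) ℓ₂) (sum-zero term)
        where
        term : ∀ x → ℓ₁ x * ℓ₂ x ≡ + 0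
        term x with ℓ₁-values x | ℓ₂ x ℤₚ.≟ + 0
        ... | inj₁ p | _ = trans (cong (_* ℓ₂ x) p) (zeroˡ _)
        ... | inj₂ _ | yes q = trans (cong (ℓ₁ x *_) q) (zeroʳ _)
        ... | inj₂ (p , _) | no ¬q with ℓ₂-support ¬q
        ... | y , xy , yr = ⊥-elim (no-triangle xy yr (local-sym p))

      ℓ₂-root : ℓ₂ r ≡ + 4
      ℓ₂-root = trans (sym (ip-δ r ℓ₂)) closed₂

      -- Two distinct midpoints of 2-walks from x to r would form a quadrangle.
      ℓ₂-values : ∀ x → ¬ r ≡ x → ℓ₂ x ≡ + 0 ⊎ ℓ₂ x ≡ + 1
      ℓ₂-values x r≢x with ℓ₂ x ℤₚ.≟ + 0
      ... | yes p = inj₁ p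
      ... | no ¬p with ℓ₂-support ¬p
      ... | y , xy , yr = inj₂ (trans (sum-cong-≗ term) (trans (sum-δ y (λ _ → + 1)) refl))
        where
        term : ∀ t → L x t * ℓ₁ t ≡ δ y t * + 1
        term t with y ≟ t
        ... | yes refl = cong₂ _*_ xy (trans (ℓ₁≗ y) yr)
        ... | no y≢t with (L x t * ℓ₁ t) ℤₚ.≟ + 0
        ... | yes q = trans q (sym (zeroˡ _))
        ... | no ¬q = ⊥-elim (no-quadrangle xy yr (local-sym (proj₂ (L-δ-support ¬q)))
            (local-sym (proj₁ (L-δ-support ¬q))) (λ e → r≢x (sym e)) y≢t)

      -- The count is ⟨ ℓ₂ , ℓ₂ ⟩. As ℓ₂ is 4 at r and 0 or 1 elsewhere, its square is ℓ₂ + 12 δ r,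
      -- of sum 16 + 12.
      closed₄ : closed 4 ≡ + 28
      closed₄ = trans (·-adjoint L-sym (δ r) (pow 3 (δ r))) (trans (·-adjoint L-sym ℓ₁ ℓ₂)
        (trans (sum-cong-≗ term) (trans (sum-linear₃ (+ 1) (+ 12) (+ 0) ℓ₂ (δ r) (δ r))
        (trans (cong₂ (λ s t → + 1 * s + + 12 * t + + 0 * t) sum-ℓ₂ sum-δr)
            (solve 0 (κ 1 :* κ 16 :+ κ 12 :* κ 1 :+ κ 0 :* κ 1 := κ 28) refl)))))
        where
        term : ∀ x → ℓ₂ x * ℓ₂ x ≡ + 1 * ℓ₂ x + + 12 * δ r x + + 0 * δ r x
        term x with r ≟ x
        ... | yes refl = trans (cong (λ z → z * z) ℓ₂-root)
            (trans (solve 0 (κ 4 :* κ 4 := κ 1 :* κ 4 :+ κ 12 :* κ 1 :+ κ 0 :* κ 1) refl)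
            (cong (λ z → + 1 * z + + 12 * + 1 + + 0 * + 1) (sym ℓ₂-root)))
        ... | no r≢x with ℓ₂-values x r≢x
        ... | inj₁ p = trans (cong (λ z → z * z) p)
            (trans (solve 0 (κ 0 :* κ 0 := κ 1 :* κ 0 :+ κ 12 :* κ 0 :+ κ 0 :* κ 0) refl)
            (cong (λ z → + 1 * z + + 12 * + 0 + + 0 * + 0) (sym p)))
        ... | inj₂ p = trans (cong (λ z → z * z) p)
            (trans (solve 0 (κ 1 :* κ 1 := κ 1 :* κ 1 :+ κ 12 :* κ 0 :+ κ 0 :* κ 0) refl)
            (cong (λ z → + 1 * z + + 12 * + 0 + + 0 * + 0) (sym p)))

      -- The count is ⟨ ℓ₂ , L ℓ₂ ⟩. A nonzero term joins the ends of two 2-walks from r by an edge,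
      -- which closes a 5-walk.
      closed₅ : closed 5 ≡ + 0
      closed₅ = trans (·-adjoint L-sym (δ r) (pow 4 (δ r)))
          (trans (·-adjoint L-sym ℓ₁ (pow 3 (δ r)))
        (sum-zero (λ x → trans (*-distribˡ-sum (ℓ₂ x) (λ y → L x y * ℓ₂ y)) (sum-zero (term x)))))
        where
        term : ∀ x y → ℓ₂ x * (L x y * ℓ₂ y) ≡ + 0
        term x y with ℓ₂ x ℤₚ.≟ + 0 | L-values x y | ℓ₂ y ℤₚ.≟ + 0
        ... | yes p | _ | _ = trans (cong (_* (L x y * ℓ₂ y)) p) (zeroˡ _)
        ... | no _ | inj₁ q | _ = trans (cong (λ z → ℓ₂ x * (z * ℓ₂ y)) q)
            (solve 2 (λ s t → s :* (κ 0 :* t) := κ 0) refl (ℓ₂ x) (ℓ₂ y))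
        ... | no _ | inj₂ _ | yes t = trans (cong (λ z → ℓ₂ x * (L x y * z)) t)
            (solve 2 (λ s t → s :* (t :* κ 0) := κ 0) refl (ℓ₂ x) (L x y))
        ... | no p | inj₂ (_ , _ , _ , xy) | no t with ℓ₂-support p | ℓ₂-support t
        ... | s , xs , sr | u , yu , ur = ⊥-elim
            (no-pentagon xy yu ur (local-sym sr) (local-sym xs))

    -- Extremality of the local graph

    -- q(t) = t (t + 2) (t + 4), -γ = -(t² + 8 t + 24) with (2 - t) γ = 48 - q, and
    -- p = (48 + q) γ.
    q -γ p : Poly
    q = + 0 ∷ + 8 ∷ + 6 ∷ + 1 ∷ []
    -γ = (ℤ.- + 24) ∷ (ℤ.- + 8) ∷ (ℤ.- + 1) ∷ []
    p = + 1152 ∷ + 576 ∷ + 256 ∷ + 80 ∷ + 14 ∷ + 1 ∷ []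

    pow-nonneg : ∀ k {f} → (∀ x → + 0 ≤ f x) → ∀ x → + 0 ≤ pow k f x
    pow-nonneg zero h = h
    pow-nonneg (suc k) h = L·-nonneg (pow-nonneg k h)

    δ-nonneg : ∀ (x y : V) → + 0 ≤ δ x y
    δ-nonneg x y with x ≟ y
    ... | yes _ = +≤+ z≤n
    ... | no _ = +≤+ z≤n

    module _ {r : V} (r∈ : a r ≡ + 1) where
      open Root r∈

      private
        form : + 16 * (+ 2 * ⟨ poly q (δ r) , poly q (δ r) ⟩ - ⟨ poly q (δ r) , L · poly q (δ r) ⟩)
            + sum (poly q (δ r)) * sum (poly q (δ r))
          ≡ + 160 * (+ 304 - closed 6) - + 16 * closed 7
        form = evaluate (P.ip-poly-poly q q (δ r)) (ip-poly-L q q (δ r)) (sum-poly q δ-supported)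
            sum-δr closed₂ closed₃ closed₄ closed₅
          where
          evaluate : ∀ {i j s t z₀ z₁ z₂ z₃ z₄ z₅ z₆ z₇} →
            i ≡ + 0 * z₀ + (+ 0 * z₁ + (+ 64 * z₂
                + (+ 96 * z₃ + (+ 52 * z₄ + (+ 12 * z₅ + (+ 1 * z₆ + + 0)))))) →
            j ≡ + 0 * z₀ + (+ 0 * z₁ + (+ 0 * z₂
                + (+ 64 * z₃ + (+ 96 * z₄ + (+ 52 * z₅ + (+ 12 * z₆ + (+ 1 * z₇ + + 0))))))) →
            s ≡ + 192 * t → t ≡ + 1 → z₂ ≡ + 4 → z₃ ≡ + 0 → z₄ ≡ + 28 → z₅ ≡ + 0 →
            + 16 * (+ 2 * i - j) + s * s ≡ + 160 * (+ 304 - z₆) - + 16 * z₇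
          evaluate {z₀ = z₀} {z₁} {z₆ = z₆} {z₇} refl refl refl refl refl refl refl refl = solve 4
              (λ z₀ z₁ z₆ z₇ →
            κ 16 :* (κ 2 :* (κ 0 :* z₀ :+ (κ 0 :* z₁
                :+ (κ 64 :* κ 4 :+ (κ 96 :* κ 0
                :+ (κ 52 :* κ 28 :+ (κ 12 :* κ 0 :+ (κ 1 :* z₆ :+ κ 0)))))))
               :- (κ 0 :* z₀ :+ (κ 0 :* z₁ :+ (κ 0 :* κ 4
                   :+ (κ 64 :* κ 0 :+ (κ 96 :* κ 28
                   :+ (κ 52 :* κ 0 :+ (κ 12 :* z₆ :+ (κ 1 :* z₇ :+ κ 0)))))))))
              :+ (κ 192 :* κ 1) :* (κ 192 :* κ 1)
            := κ 160 :* (κ 304 :- z₆) :- κ 16 :* z₇) refl z₀ z₁ z₆ z₇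

        form≥0 : + 0 ≤ + 160 * (+ 304 - closed 6) - + 16 * closed 7
        form≥0 = subst (+ 0 ≤_) form (local-nonneg (poly-supported q δ-supported))

        closed₇≥0 : + 0 ≤ + 16 * closed 7
        closed₇≥0 = *-nonneg {+ 16} (+≤+ z≤n)
            (sum-nonneg (λ x → *-nonneg (δ-nonneg r x) (pow-nonneg 7 (δ-nonneg r) x)))

      -- Positivity at q(L) δ r reads 160 (304 - `closed 6`) ≥ 16 `closed 7`, and the number of
      -- closed 7-walks is nonnegative.
      closed₆-bound : + 0 ≤ + 304 - closed 6
      closed₆-bound = *-nonneg-cancelˡ 159
          (subst (+ 0 ≤_) (solve 2 (λ s t → (s :- t) :+ t := s) refl (+ 160 * (+ 304 - closed 6))
          (+ 16 * closed 7)) (+-nonneg form≥0 closed₇≥0))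

      -- Equality leaves -16 `closed 7` ≥ 0, so there are no closed 7-walks and the form vanishes at
      -- q(L) δ r. Then `local-zero` gives 16 (2 - L) q(L) δ r + 192 a = 0, where 192 = q(4) is the
      -- sum of q(L) δ r.
      closed₆-equality : + 304 - closed 6 ≡ + 0 → ∀ x → poly ((ℤ.- + 2) ∷ + 1 ∷ []) (poly q (δ r)) x
          ≡ + 12 * a x
      closed₆-equality h x = *-cancelˡ 15 (-≡0⇒≡ (trans
          (trans (cong (λ z → + 16 * z - + 16 * (+ 12 * a x))
              (linear-poly (ℤ.- + 2) (poly q (δ r)) x))
          (trans (solve 3 (λ f l a → κ 16 :* (con (ℤ.- + 2) :* f :+ l) :- κ 16 :* (κ 12 :* a)
              := :- (κ 16 :* (κ 2 :* f :- l) :+ κ 192 :* a)) refl (poly q (δ r) x)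
              ((L · poly q (δ r)) x) (a x))
          (cong (λ z → - (+ 16 * (+ 2 * poly q (δ r) x - (L · poly q (δ r)) x) + z * a x))
              (sym (trans (sum-poly q δ-supported)
              (trans (cong (+ 192 *_) sum-δr) (solve 0 (κ 192 :* κ 1 := κ 192) refl)))))))
        (trans (cong -_ (local-zero (poly-supported q δ-supported) (trans form form≡0) x))
            (solve 0 (:- κ 0 := κ 0) refl))))
        where
        form≡- : + 160 * (+ 304 - closed 6) - + 16 * closed 7 ≡ - (+ 16 * closed 7)
        form≡- = trans (cong (λ z → + 160 * z - + 16 * closed 7) h)
            (solve 1 (λ z → κ 160 :* κ 0 :- z := :- z) refl (+ 16 * closed 7))
        form≡0 : + 160 * (+ 304 - closed 6) - + 16 * closed 7 ≡ + 0
        form≡0 = trans form≡- (trans (cong -_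
            (≤-antisym-0 closed₇≥0 (subst (+ 0 ≤_) form≡- form≥0))) (solve 0 (:- κ 0 := κ 0) refl))

    -- Approximate projections and the sum of their squared errors

    module _ (u : V) where

      -- The inner products of u with the neighbours of v in the eigenspace: the right-hand side of
      -- the normal equations for projecting u onto their span.
      c : Function
      c x = a x * E u x

      c-supported : Supported c
      c-supported x = trans (sym (*-assoc (a x) (a x) (E u x))) (cong (_* E u x) (A-idem v x))

      ε : ℤ
      ε = E u v

      ip-c : ∀ {f} → Supported f → (E · f) u ≡ ⟨ c , f ⟩
      ip-c {f} s = sum-cong-≗ (λ x → trans (cong (E u x *_) (sym (s x)))
          (solve 3 (λ e a f → e :* (a :* f) := a :* e :* f) refl (E u x) (a x) (f x)))

      sum-c : sum c ≡ (ℤ.- + 10) * ε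
      sum-c = trans (ip-congʳ a (λ x → trans (radial-sym e u x) (sym (·-δ E u x))))
        (trans (radial-eigenfunction tridiagonal-e (δ u) v)
            (cong ((ℤ.- + 10) *_) (trans (·-δ E u v) (radial-sym e v u))))

      -- In the eigenspace of -10, F is a multiple of u minus an approximation of
      -- its projection onto the span of v and its neighbours.
      f F : Function
      f = poly -γ c
      F = linear₃ (+ 336) (+ 1) (+ 204 * ε) (δ u) f (δ v)

      f-supported : Supported f
      f-supported = poly-supported -γ c-supported

      -- The factor 720 = (-γ(4)) · (-10) determines the coefficient of δ v in `F`: as 336 - 5 · 720
      -- + 16 · 204 = 0, `F` is orthogonal to v in the eigenspace. This corrects the constant
      -- component, on which γ(L) is not the right inverse.
      sum-f : sum f ≡ + 720 * ε
      sum-f = trans (sum-poly -γ c-supported)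
          (trans (cong ((ℤ.- + 72) *_) sum-c)
          (solve 1 (λ ε → con (ℤ.- + 72) :* (con (ℤ.- + 10) :* ε) := κ 720 :* ε) refl ε))

      E·F : ∀ x → (E · F) x ≡ + 336 * E x u + + 1 * (E · f) x + + 204 * ε * E x v
      E·F x = trans (·-linear E (+ 336) (+ 1) (+ 204 * ε) (δ u) f (δ v) x)
        (cong₂ (λ s t → + 336 * s + + 1 * (E · f) x + + 204 * ε * t) (·-δ E u x) (·-δ E v x))

      N : ℤ
      N = ⟨ F , E · F ⟩

      N-nonneg : + 0 ≤ N
      N-nonneg = form-nonneg (radial-sym e) 335 E-square F

      N-zero : N ≡ + 0 → ∀ x → (E · F) x ≡ + 0
      N-zero = form-zero (radial-sym e) 335 E-square F

      -- The constant is 336² · 16. The terms quadratic in c combine to -672 γ + 7 (2 - t) γ² = -7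
      -- (48 + q) γ, which is how p arises; everything caused by v and by the sum of f collects in
      -- the multiple of ε².
      N-formula : N ≡ + 1806336 + + 370944 * (ε * ε) - + 7 * ⟨ c , poly p c ⟩
      N-formula = trans (ip-linearˡ (+ 336) (+ 1) (+ 204 * ε) (δ u) f (δ v) (E · F))
        (evaluate (trans (ip-δ u (E · F)) (E·F u)) ip-f-EF (trans (ip-δ v (E · F)) (E·F v))
            (E-self u) (E-self v) (radial-sym e v u)
          (ip-c f-supported) (P.ip-poly -γ c c) (E-centre f-supported) sum-f
              (ip-E-local f-supported f-supported)
          (P.ip-poly-poly -γ -γ c) (ip-poly-L -γ -γ c) (P.ip-poly p c c))
        where
        ip-f-EF : ⟨ f , E · F ⟩ ≡ + 336 * (E · f) u + + 1 * ⟨ f , E · f ⟩ + + 204 * ε * (E · f) v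
        ip-f-EF = trans (ip-congʳ f E·F)
            (trans (ip-linearʳ (+ 336) (+ 1) (+ 204 * ε) (λ x → E x u) (E · f) (λ x → E x v) f)
          (cong₂ (λ s t → + 336 * s + + 1 * ⟨ f , E · f ⟩ + + 204 * ε * t)
            (trans (ip-comm f _) (ip-congˡ f (λ x → radial-sym e x u)))
                (trans (ip-comm f _) (ip-congˡ f (λ x → radial-sym e x v)))))
        evaluate : ∀ {ε i j k euu evv evu eu cf ev sf fef ff flf m y₀ y₁ y₂ y₃ y₄ y₅} →
          i ≡ + 336 * euu + + 1 * eu + + 204 * ε * ε → j ≡ + 336 * eu + + 1 * fef + + 204 * ε * ev
              → k ≡ + 336 * evu + + 1 * ev + + 204 * ε * evv →
          euu ≡ + 16 → evv ≡ + 16 → evu ≡ ε → eu ≡ cf → cf ≡ (ℤ.- + 24) * y₀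
              + ((ℤ.- + 8) * y₁ + ((ℤ.- + 1) * y₂ + + 0)) →
          ev ≡ (ℤ.- + 5) * sf → sf ≡ + 720 * ε → fef ≡ + 14 * ff + + 2 * (sf * sf) - + 7 * flf →
          ff ≡ + 576 * y₀ + (+ 384 * y₁ + (+ 112 * y₂ + (+ 16 * y₃ + (+ 1 * y₄ + + 0)))) →
          flf ≡ + 0 * y₀ + (+ 576 * y₁ + (+ 384 * y₂
              + (+ 112 * y₃ + (+ 16 * y₄ + (+ 1 * y₅ + + 0))))) →
          m ≡ + 1152 * y₀ + (+ 576 * y₁ + (+ 256 * y₂
              + (+ 80 * y₃ + (+ 14 * y₄ + (+ 1 * y₅ + + 0))))) →
          + 336 * i + + 1 * j + + 204 * ε * k ≡ + 1806336 + + 370944 * (ε * ε) - + 7 * m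
        evaluate {ε} {y₀ = y₀} {y₁} {y₂} {y₃} {y₄} {y₅} refl refl refl refl refl refl refl refl refl
            refl refl refl refl refl =
          solve 7 (λ ε y₀ y₁ y₂ y₃ y₄ y₅ →
            let cf = con (ℤ.- + 24) :* y₀ :+ (con (ℤ.- + 8) :* y₁ :+ (con (ℤ.- + 1) :* y₂ :+ κ 0))
                sf = κ 720 :* ε
                ev = con (ℤ.- + 5) :* sf
                ff = κ 576 :* y₀ :+ (κ 384 :* y₁
                    :+ (κ 112 :* y₂ :+ (κ 16 :* y₃ :+ (κ 1 :* y₄ :+ κ 0))))
                flf = κ 0 :* y₀ :+ (κ 576 :* y₁
                    :+ (κ 384 :* y₂ :+ (κ 112 :* y₃ :+ (κ 16 :* y₄ :+ (κ 1 :* y₅ :+ κ 0)))))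
                fef = κ 14 :* ff :+ κ 2 :* (sf :* sf) :- κ 7 :* flf
                m = κ 1152 :* y₀ :+ (κ 576 :* y₁
                    :+ (κ 256 :* y₂ :+ (κ 80 :* y₃ :+ (κ 14 :* y₄ :+ (κ 1 :* y₅ :+ κ 0)))))
            in κ 336 :* (κ 336 :* κ 16 :+ κ 1 :* cf :+ κ 204 :* ε :* ε) :+ κ 1
                :* (κ 336 :* cf :+ κ 1 :* fef :+ κ 204 :* ε :* ev)
                 :+ κ 204 :* ε :* (κ 336 :* ε :+ κ 1 :* ev :+ κ 204 :* ε :* κ 16)
               := κ 1806336 :+ κ 370944 :* (ε :* ε) :- κ 7 :* m) refl ε y₀ y₁ y₂ y₃ y₄ y₅

    ζ : V → ℤ
    ζ r = ⟨ δ r , pow 6 (δ r) ⟩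

    a-values : ∀ x → a x ≡ + 0 ⊎ a x ≡ + 1
    a-values x with A-values v x
    ... | inj₁ h = inj₁ h
    ... | inj₂ (_ , h) = inj₂ h

    poly-kernel : ∀ p f x → poly p f x ≡ sum (λ r → f r * poly p (δ r) x)
    poly-kernel p f x = trans (sym (ip-δ x (poly p f)))
        (trans (P.poly-adjoint p (δ x) f) (sum-cong-≗ (λ r →
      trans (cong (_* f r) (trans (sym (ip-δ r (poly p (δ x))))
          (trans (P.poly-adjoint p (δ r) (δ x)) (ip-δʳ (poly p (δ r)) x)))) (*-comm _ _))))

    -- Summation over u turns the two factors into E² = 336 E. The remaining value of E p(L) δ r at
    -- r is local, and involves closed walks of length at most 6, of which only the number of
    -- 6-walks is still unknown.
    column-sum : ∀ r → sum (λ u → c u r * ⟨ c u , poly p (δ r) ⟩) ≡ + 336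
        * (a r * (+ 38704 - + 7 * ζ r))
    column-sum r with a-values r
    ... | inj₁ h = trans (sum-zero (λ u → trans (cong (λ z → z * E u r * ⟨ c u , poly p (δ r) ⟩) h)
        (solve 2 (λ s t → κ 0 :* s :* t := κ 0) refl (E u r) ⟨ c u , poly p (δ r) ⟩)))
      (sym (trans (cong (λ z → + 336 * (z * (+ 38704 - + 7 * ζ r))) h)
          (solve 1 (λ s → κ 336 :* (κ 0 :* s) := κ 0) refl (+ 38704 - + 7 * ζ r))))
    ... | inj₂ r∈ = trans (sum-cong-≗
        (λ u → cong₂ _*_ (trans (cong (_* E u r) r∈) (trans (*-identityˡ _) (radial-sym e u r)))
        (sym (ip-c u (poly-supported p δ-supported)))))
      (trans (E-square (poly p (δ r)) r)
      (trans (cong (+ 336 *_) (trans (sym (*-identityˡ _))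
          (trans (cong (_* (E · poly p (δ r)) r) (sym r∈))
          (E-local (poly-supported p δ-supported) r))))
        (evaluate (trans (sym (ip-δ r (poly p (δ r)))) (P.ip-poly p (δ r) (δ r)))
          (trans (sym (ip-δ r (L · poly p (δ r))))
              (trans (ip-congʳ (δ r) (L-poly p (δ r))) (P.ip-poly (+ 0 ∷ p) (δ r) (δ r))))
          (trans (sum-poly p δ-supported) (cong (+ 17280 *_) sum-δr)) closed₀ closed₁ closed₂
              closed₃ closed₄ closed₅ r∈)))
      where
      open Root r∈
      evaluate : ∀ {i j s b z₀ z₁ z₂ z₃ z₄ z₅ z₆} →
        i ≡ + 1152 * z₀ + (+ 576 * z₁ + (+ 256 * z₂ + (+ 80 * z₃ + (+ 14 * z₄ + (+ 1 * z₅ + + 0)))))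
            →
        j ≡ + 0 * z₀ + (+ 1152 * z₁ + (+ 576 * z₂
            + (+ 256 * z₃ + (+ 80 * z₄ + (+ 14 * z₅ + (+ 1 * z₆ + + 0)))))) →
        s ≡ + 17280 * + 1 → z₀ ≡ + 1 → z₁ ≡ + 0 → z₂ ≡ + 4 → z₃ ≡ + 0 → z₄ ≡ + 28 → z₅ ≡ + 0 → b
            ≡ + 1 →
        + 336 * (+ 14 * i + + 2 * (s * b) - + 7 * j) ≡ + 336 * (b * (+ 38704 - + 7 * z₆))
      evaluate {z₆ = z₆} refl refl refl refl refl refl refl refl refl refl = solve 1 (λ z₆ →
        κ 336 :* (κ 14 :* (κ 1152 :* κ 1
            :+ (κ 576 :* κ 0 :+ (κ 256 :* κ 4
            :+ (κ 80 :* κ 0 :+ (κ 14 :* κ 28 :+ (κ 1 :* κ 0 :+ κ 0))))))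
          :+ κ 2 :* ((κ 17280 :* κ 1) :* κ 1)
          :- κ 7 :* (κ 0 :* κ 1 :+ (κ 1152 :* κ 0
              :+ (κ 576 :* κ 4 :+ (κ 256 :* κ 0
              :+ (κ 80 :* κ 28 :+ (κ 14 :* κ 0 :+ (κ 1 :* z₆ :+ κ 0))))))))
        := κ 336 :* (κ 1 :* (κ 38704 :- κ 7 :* z₆))) refl z₆

    -- The total deficit of closed 6-walks relative to the bound 304.
    T : ℤ
    T = sum (λ r → a r * (+ 304 - ζ r))

    sum-ip-poly : sum (λ u → ⟨ c u , poly p (c u) ⟩) ≡ + 336 * (+ 1170432 + + 7 * T)
    sum-ip-poly = trans (sum-cong-≗
        (λ u → trans (ip-congʳ (c u) (poly-kernel p (c u)))
        (trans (ip-sumʳ (c u) (λ r x → c u r * poly p (δ r) x))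
        (sum-cong-≗ (λ r → ip-scaleʳ (c u r) (c u) (poly p (δ r)))))))
      (trans (∑-comm (λ u r → c u r * ⟨ c u , poly p (δ r) ⟩)) (trans (sum-cong-≗ column-sum)
      (trans (sym (*-distribˡ-sum (+ 336) (λ r → a r * (+ 38704 - + 7 * ζ r)))) (cong (+ 336 *_)
        -- 36576 = 38704 - 7 · 304: the count is recentred at the bound, so that `T` appears.
        (trans (sum-cong-≗ (λ r → solve 2
            (λ a z → a :* (κ 38704 :- κ 7 :* z) := κ 36576 :* a :+ κ 7 :* (a :* (κ 304 :- z)) :+ κ 0
            :* a) refl (a r) (ζ r)))
        (trans (sum-linear₃ (+ 36576) (+ 7) (+ 0) a (λ r → a r * (+ 304 - ζ r)) a)
        (trans (cong (λ s → + 36576 * s + + 7 * T + + 0 * s) sum-a)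
            (solve 1 (λ t → κ 36576 :* κ 32 :+ κ 7 :* t :+ κ 0 :* κ 32 := κ 1170432 :+ κ 7 :* t)
            refl T))))))))

    sum-ε-square : sum (λ u → ε u * ε u) ≡ + 5376
    sum-ε-square = trans (sum-cong-≗ (λ u → cong₂ _*_ (radial-sym e u v) (sym (·-δ E v u))))
        (trans (E-square (δ v) v)
      (trans (cong (+ 336 *_) (trans (·-δ E v v) (E-self v)))
          (solve 0 (κ 336 :* κ 16 := κ 5376) refl)))

    -- The multiplicity of -10 enters here: n · 16 = 420 · 16 = 336 · 20.
    sum-N : sum N ≡ - (+ 16464 * T)
    sum-N = trans (sum-cong-≗ (λ u → trans (N-formula u)
        (solve 2 (λ s t → κ 1806336 :+ κ 370944 :* s :- κ 7 :* t := κ 1806336 :* κ 1 :+ κ 370944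
        :* s :+ con (ℤ.- + 7) :* t) refl (ε u * ε u) ⟨ c u , poly p (c u) ⟩)))
      (trans (sum-linear₃ (+ 1806336) (+ 370944) (ℤ.- + 7) (λ _ → + 1) (λ u → ε u * ε u)
          (λ u → ⟨ c u , poly p (c u) ⟩))
        (evaluate (sum-1 v) sum-ε-square sum-ip-poly))
      where
      evaluate : ∀ {i j k} → i ≡ + 420 → j ≡ + 5376 → k ≡ + 336 * (+ 1170432 + + 7 * T) → + 1806336
          * i + + 370944 * j + (ℤ.- + 7) * k ≡ - (+ 16464 * T)
      evaluate refl refl refl = solve 1
          (λ t → κ 1806336 :* κ 420 :+ κ 370944 :* κ 5376 :+ con (ℤ.- + 7)
          :* (κ 336 :* (κ 1170432 :+ κ 7 :* t)) := :- (κ 16464 :* t)) refl T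

    T-terms : ∀ r → + 0 ≤ a r * (+ 304 - ζ r)
    T-terms r with a-values r
    ... | inj₁ h = subst (+ 0 ≤_) (trans (sym (zeroˡ (+ 304 - ζ r)))
        (cong (_* (+ 304 - ζ r)) (sym h))) (+≤+ z≤n)
    ... | inj₂ h = subst (+ 0 ≤_) (trans (sym (*-identityˡ (+ 304 - ζ r)))
        (cong (_* (+ 304 - ζ r)) (sym h))) (closed₆-bound h)

    -- The squared errors are nonnegative by positivity of `E`, the deficit by `closed₆-bound`,
    -- while `sum-N` says that the two add up to 0.
    extremal : sum N ≡ + 0 × + 16464 * T ≡ + 0
    extremal = +-zero-nonneg (sum-nonneg N-nonneg)
        (*-nonneg {+ 16464} (+≤+ z≤n) (sum-nonneg T-terms))
      (trans (cong (_+ + 16464 * T) sum-N) (solve 1 (λ t → :- t :+ t := κ 0) refl (+ 16464 * T)))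

    E·F≡0 : ∀ u x → (E · F u) x ≡ + 0
    E·F≡0 u = N-zero u (sum-zero-nonneg N-nonneg (proj₁ extremal) u)

    local-identity : ∀ {r} → a r ≡ + 1 → ∀ x → poly ((ℤ.- + 2) ∷ + 1 ∷ []) (poly q (δ r)) x ≡ + 12
        * a x
    local-identity {r} r∈ = closed₆-equality r∈
        (trans (sym (*-identityˡ _)) (trans (cong (_* (+ 304 - ζ r)) (sym r∈))
      (sum-zero-nonneg T-terms (*-cancelˡ 16463 (trans (proj₂ extremal) (sym (zeroʳ (+ 16464)))))
          r)))

    -- Pairs of vertices at distance 2

    poly-linear : ∀ p α β γ f g h x → poly p (linear₃ α β γ f g h) x ≡ α * poly p f x + β * poly p g
        x + γ * poly p h x
    poly-linear p α β γ f g h x = trans (at-x _) (trans (ip-linearʳ α β γ f g h (poly p (δ x)))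
      (cong₂ _+_ (cong₂ _+_ (cong (α *_) (sym (at-x f))) (cong (β *_) (sym (at-x g))))
          (cong (γ *_) (sym (at-x h)))))
      where
      at-x : ∀ k → poly p k x ≡ ⟨ poly p (δ x) , k ⟩
      at-x k = trans (sym (ip-δ x (poly p k))) (P.poly-adjoint p (δ x) k)

    poly-a : ∀ p x → poly p a x ≡ horner (+ 4) p * a x
    poly-a p = P.poly-eigen p L-a

    poly-δ-sym : ∀ p x y → poly p (δ x) y ≡ poly p (δ y) x
    poly-δ-sym p x y = trans (sym (ip-δ y (poly p (δ x))))
        (trans (P.poly-adjoint p (δ y) (δ x)) (ip-δʳ (poly p (δ y)) x))

    -- π(t) = t (t - 2) (t + 2), so (t + 4) π = (t - 2) q and the local identity becomes (L + 4)
    -- π(L) δ r = 12 a. Thus π(L) δ r consists of a constant and an eigenfunction of -4.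
    π : Poly
    π = + 0 ∷ (ℤ.- + 4) ∷ + 0 ∷ + 1 ∷ []

    -- The sum of L x y (σ x + σ y)² over all pairs is 8 ⟨ σ , σ ⟩ + 2 ⟨ σ , L σ ⟩, which is 0 for
    -- the eigenvalue -4; so each term vanishes.
    alternating : ∀ {σ} → Supported σ → (∀ x → (L · σ) x ≡ (ℤ.- + 4) * σ x) → ∀ {x y}
        → LocallyAdjacent x y → σ x + σ y ≡ + 0
    alternating {σ} s eigen {x} {y} xy = square-zero
        (trans (sym (*-identityˡ _)) (trans (cong (_* ((σ x + σ y) * (σ x + σ y))) (sym xy))
      (sum-zero-nonneg (λ y → term≥0 x y) (sum-zero-nonneg (λ x → sum-nonneg (term≥0 x)) total x)
          y)))
      where
      term≥0 : ∀ x y → + 0 ≤ L x y * ((σ x + σ y) * (σ x + σ y))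
      term≥0 x y = *-nonneg (L-nonneg x y) (square-nonneg (σ x + σ y))
      L-a-right : ∀ x y → L x y * a y ≡ L x y
      L-a-right x y = trans (*-assoc _ _ _) (cong (a x * A x y *_) (A-idem v y))
      row : ∀ x → sum (λ y → L x y * ((σ x + σ y) * (σ x + σ y))) ≡ σ x * σ x * (L · a) x + + 2 * σ
          x * (L · σ) x + + 1 * (L · (λ y → σ y * σ y)) x
      row x = trans (sum-cong-≗ (λ y → trans
          (solve 3 (λ l s t → l :* ((s :+ t) :* (s :+ t)) := (s :* s) :* l :+ (κ 2 :* s) :* (l :* t)
          :+ κ 1 :* (l :* (t :* t))) refl (L x y) (σ x) (σ y))
          (cong (λ l → σ x * σ x * l + + 2 * σ x * (L x y * σ y) + + 1 * (L x y * (σ y * σ y)))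
              (sym (L-a-right x y)))))
        (sum-linear₃ (σ x * σ x) (+ 2 * σ x) (+ 1) (λ y → L x y * a y) (λ y → L x y * σ y)
            (λ y → L x y * (σ y * σ y)))
      σ² : Function
      σ² y = σ y * σ y
      σ²-supported : Supported σ²
      σ²-supported y = trans (sym (*-assoc _ _ _)) (cong (_* σ y) (s y))
      total : sum (λ x → sum (λ y → L x y * ((σ x + σ y) * (σ x + σ y)))) ≡ + 0
      total = trans (sum-cong-≗ (λ x → trans (row x)
          (trans (cong₂ (λ p q → σ x * σ x * p + + 2 * σ x * q + + 1 * (L · σ²) x) (L-a x)
          (eigen x))
          (trans (solve 3 (λ s a l → s :* s :* (κ 4 :* a) :+ κ 2 :* s :* (con (ℤ.- + 4) :* s) :+ κ 1
              :* l := κ 4 :* (a :* (s :* s)) :+ con (ℤ.- + 8) :* (s :* s) :+ κ 1 :* l) refl (σ x)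
              (a x) ((L · σ²) x))
          (cong (λ z → + 4 * z + (ℤ.- + 8) * σ² x + + 1 * (L · σ²) x) (σ²-supported x))))))
        (trans (sum-linear₃ (+ 4) (ℤ.- + 8) (+ 1) σ² σ² (L · σ²))
            (trans (cong (λ z → + 4 * sum σ² + (ℤ.- + 8) * sum σ² + + 1 * z) (sum-L σ²-supported))
          (solve 1 (λ s → κ 4 :* s :+ con (ℤ.- + 8) :* s :+ κ 1 :* (κ 4 :* s) := κ 0) refl
              (sum σ²))))

    -- The local part 12 + 3 L of `Γ` annihilates σ, so the Gram form is 0 at σ. Positivity then
    -- extends the vanishing from the neighbours of v to all vertices.
    Γ-null : ∀ {σ} → Supported σ → (∀ x → (L · σ) x ≡ (ℤ.- + 4) * σ x) → ∀ x → (Γ · σ) x ≡ + 0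
    Γ-null {σ} s eigen = form-zero (radial-sym g) 47 Γ-square σ (sum-zero (λ x →
      trans (cong (_* (Γ · σ) x) (sym (s x)))
          (trans (solve 3 (λ a s k → a :* s :* k := s :* (a :* k)) refl (a x) (σ x) ((Γ · σ) x))
      (trans (cong (σ x *_) (trans (Γ-local s x) (cong (λ z → + 12 * σ x + + 3 * z) (eigen x))))
          (solve 1 (λ s → s :* (κ 12 :* s :+ κ 3 :* (con (ℤ.- + 4) :* s)) := κ 0) refl (σ x))))))

    module _ {r : V} (r∈ : a r ≡ + 1) where

      -- Three times the ±1 bipartition function of the local graph that is
      -- positive at r.
      σ : Function
      σ = linear₃ (+ 3) (ℤ.- + 2) (+ 0) a (poly π (δ r)) a

      σ-supported : Supported σ
      σ-supported x = trans (solve 3 (λ a p b → b :* (κ 3 :* a :+ con (ℤ.- + 2) :* p :+ κ 0 :* a)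
          := κ 3 :* (b :* a) :+ con (ℤ.- + 2) :* (b :* p) :+ κ 0 :* (b :* a)) refl (a x)
          (poly π (δ r) x) (a x))
        (cong₂ (λ p q → + 3 * p + (ℤ.- + 2) * q + + 0 * p) (a-supported x)
            (poly-supported π (Root.δ-supported r∈) x))

      σ-eigen : ∀ x → (L · σ) x ≡ (ℤ.- + 4) * σ x
      σ-eigen x = trans (·-linear L (+ 3) (ℤ.- + 2) (+ 0) a (poly π (δ r)) a x)
        (evaluate (L-a x) (L-poly π (δ r) x)
            (trans (sym (P.poly-⊕ (+ 0 ∷ π) (scale (+ 4) π) (δ r) x))
            (trans (P.poly-⊗ ((ℤ.- + 2) ∷ + 1 ∷ []) q (δ r) x) (local-identity r∈ x)))
            (P.poly-scale (+ 4) π (δ r) x))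
        where
        evaluate : ∀ {a′ l l′ k b p} → l ≡ + 4 * a′ → k ≡ l′ → l′ + b ≡ + 12 * a′ → b ≡ + 4 * p
            → + 3 * l + (ℤ.- + 2) * k + + 0 * l ≡ (ℤ.- + 4) * (+ 3 * a′ + (ℤ.- + 2) * p + + 0 * a′)
        evaluate {a′} {l′ = l′} {p = p} refl refl h refl = trans
            (solve 3 (λ a l p → κ 3 :* (κ 4 :* a) :+ con (ℤ.- + 2) :* l :+ κ 0 :* (κ 4 :* a) := κ 12
            :* a :+ con (ℤ.- + 2) :* (l :+ κ 4 :* p) :+ κ 8 :* p) refl a′ l′ p)
          (trans (cong (λ z → + 12 * a′ + (ℤ.- + 2) * z + + 8 * p) h)
              (solve 2 (λ a p → κ 12 :* a :+ con (ℤ.- + 2) :* (κ 12 :* a) :+ κ 8 :* p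
              := con (ℤ.- + 4) :* (κ 3 :* a :+ con (ℤ.- + 2) :* p :+ κ 0 :* a)) refl a′ p))

      π-alternating : ∀ {x y} → LocallyAdjacent x y → poly π (δ r) x + poly π (δ r) y ≡ + 3
      π-alternating {x} {y} xy = *-cancelˡ 1 (sym (-≡0⇒≡ (trans
        (trans (solve 2 (λ p q → κ 2 :* κ 3 :- κ 2 :* (p :+ q)
            := (κ 3 :* κ 1 :+ con (ℤ.- + 2) :* p :+ κ 0 :* κ 1)
            :+ (κ 3 :* κ 1 :+ con (ℤ.- + 2) :* q :+ κ 0 :* κ 1)) refl (poly π (δ r) x)
            (poly π (δ r) y))
          (cong₂ (λ s t → (+ 3 * s + (ℤ.- + 2) * poly π (δ r) x + + 0 * s)
              + (+ 3 * t + (ℤ.- + 2) * poly π (δ r) y + + 0 * t))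
            (sym (𝟙-yes (adj? v x) (proj₁ (local-members xy))))
                (sym (𝟙-yes (adj? v y) (proj₂ (proj₂ (local-members xy)))))))
        (alternating σ-supported σ-eigen xy))))

      -- Only walks of length 1 and 3 enter π, and none of them is closed.
      π-root : poly π (δ r) r ≡ + 0
      π-root = trans (sym (ip-δ r (poly π (δ r))))
          (trans (P.ip-poly π (δ r) (δ r)) (evaluate closed₁ closed₃))
        where
        open Root r∈
        evaluate : ∀ {z₀ z₁ z₂ z₃} → z₁ ≡ + 0 → z₃ ≡ + 0 → + 0 * z₀
            + ((ℤ.- + 4) * z₁ + (+ 0 * z₂ + (+ 1 * z₃ + + 0))) ≡ + 0
        evaluate {z₀} {z₂ = z₂} refl refl = solve 2
            (λ z₀ z₂ → κ 0 :* z₀ :+ (con (ℤ.- + 4) :* κ 0 :+ (κ 0 :* z₂ :+ (κ 1 :* κ 0 :+ κ 0)))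
            := κ 0) refl z₀ z₂

    module _ {u : V} (d≡2 : d v u ≡ 2) where

      private
        dist : ∀ {x} → Adj v x → d u x ≡ 1 ⊎ d u x ≡ 2 ⊎ d u x ≡ 3
        dist {x} h = by (d u x) refl (d-≤-suc {u} h) (d-≤-suc {u} (Adj-sym h))
          where
          d′ : d u v ≡ 2
          d′ = trans (d-sym u v) d≡2
          by : ∀ j → d u x ≡ j → d u x ℕ.≤ suc (d u v) → d u v ℕ.≤ suc (d u x) → d u x ≡ 1 ⊎ d u x
              ≡ 2 ⊎ d u x ≡ 3
          by 0 e₀ _ le with s≤s () ← subst₂ ℕ._≤_ d′ (cong suc e₀) le
          by 1 e₁ _ _ = inj₁ e₁
          by 2 e₂ _ _ = inj₂ (inj₁ e₂)
          by 3 e₃ _ _ = inj₂ (inj₂ e₃)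
          by (suc (suc (suc (suc j)))) e₄ le _ with s≤s (s≤s (s≤s ())) ← subst₂ ℕ._≤_ e₄
              (cong suc d′) le

      -- m is the indicator function of the neighbours of v at distance 1 or 3
      -- from u.
      t m : Function
      t x = a x * A u x
      m x = + 4 * t x - a x * Γ u x

      private
        A-≢1 : ∀ {x j} → d u x ≡ suc (suc j) → A u x ≡ + 0
        A-≢1 {x} h = 𝟙-no (adj? u x) (λ f → ℕₚ.0≢1+n (ℕₚ.suc-injective (trans (sym (Adj⇒d≡1 f)) h)))

        values : ∀ x → (a x ≡ + 0) ⊎ (a x ≡ + 1
            × ((A u x ≡ + 1 × E u x ≡ ℤ.- + 5 × Γ u x ≡ + 3)
            ⊎ (A u x ≡ + 0 × E u x ≡ + 2 × Γ u x ≡ + 0)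
            ⊎ (A u x ≡ + 0 × E u x ≡ ℤ.- + 5 × Γ u x ≡ ℤ.- + 1)))
        values x with A-values v x
        ... | inj₁ h = inj₁ h
        ... | inj₂ (f , h) with dist f
        ... | inj₁ k = inj₂ (h , inj₁ (𝟙-yes (adj? u x) (d≡1⇒Adj k) , cong e k , cong g k))
        ... | inj₂ (inj₁ k) = inj₂ (h , inj₂ (inj₁ (A-≢1 k , cong e k , cong g k)))
        ... | inj₂ (inj₂ k) = inj₂ (h , inj₂ (inj₂ (A-≢1 k , cong e k , cong g k)))

        -- On the neighbours of v the entries of the row of u follow three patterns, one for each
        -- distance. Passing to a relation R reduces pointwise identities to arithmetic with
        -- numerals.
        by-values : (R : ℤ → ℤ → ℤ → ℤ → Set) → (∀ A E Γ → R (+ 0) A E Γ) → R (+ 1) (+ 1) (ℤ.- + 5)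
            (+ 3) → R (+ 1) (+ 0) (+ 2) (+ 0) → R (+ 1) (+ 0) (ℤ.- + 5) (ℤ.- + 1) →
          ∀ x → R (a x) (A u x) (E u x) (Γ u x)
        by-values R r₀ r₁ r₂ r₃ x = go (values x)
          where
          go : ∀ {b A E Γ} → (b ≡ + 0) ⊎ (b ≡ + 1
              × ((A ≡ + 1 × E ≡ ℤ.- + 5 × Γ ≡ + 3) ⊎ (A ≡ + 0 × E ≡ + 2 × Γ ≡ + 0)
              ⊎ (A ≡ + 0 × E ≡ ℤ.- + 5 × Γ ≡ ℤ.- + 1))) → R b A E Γ
          go (inj₁ refl) = r₀ _ _ _
          go (inj₂ (refl , inj₁ (refl , refl , refl))) = r₁
          go (inj₂ (refl , inj₂ (inj₁ (refl , refl , refl)))) = r₂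
          go (inj₂ (refl , inj₂ (inj₂ (refl , refl , refl)))) = r₃

      -- As `e 1` equals `e 3`, the matrix `E` does not separate the distances 1 and 3: it takes the
      -- value 2 - 7 = -5 on the support of m and 2 off it.
      c≗ : ∀ x → c u x ≡ linear₃ (+ 2) (ℤ.- + 7) (+ 0) a m a x
      c≗ = by-values (λ b A E Γ → b * E ≡ + 2 * b + (ℤ.- + 7) * (+ 4 * (b * A) - b * Γ) + + 0 * b)
        (λ A E Γ → solve 3 (λ A E Γ → κ 0 :* E := κ 2 :* κ 0 :+ con (ℤ.- + 7)
            :* (κ 4 :* (κ 0 :* A) :- κ 0 :* Γ) :+ κ 0 :* κ 0) refl A E Γ)
        (solve 0 (κ 1 :* con (ℤ.- + 5) := κ 2 :* κ 1 :+ con (ℤ.- + 7)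
            :* (κ 4 :* (κ 1 :* κ 1) :- κ 1 :* κ 3) :+ κ 0 :* κ 1) refl)
        (solve 0 (κ 1 :* κ 2 := κ 2 :* κ 1 :+ con (ℤ.- + 7) :* (κ 4 :* (κ 1 :* κ 0) :- κ 1 :* κ 0)
            :+ κ 0 :* κ 1) refl)
        (solve 0 (κ 1 :* con (ℤ.- + 5) := κ 2 :* κ 1 :+ con (ℤ.- + 7)
            :* (κ 4 :* (κ 1 :* κ 0) :- κ 1 :* con (ℤ.- + 1)) :+ κ 0 :* κ 1) refl)

      m-idem : ∀ x → m x * m x ≡ m x
      m-idem = by-values (λ b A E Γ → (+ 4 * (b * A) - b * Γ) * (+ 4 * (b * A) - b * Γ) ≡ + 4
          * (b * A) - b * Γ)
        (λ A E Γ → solve 2 (λ A Γ → (κ 4 :* (κ 0 :* A) :- κ 0 :* Γ)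
            :* (κ 4 :* (κ 0 :* A) :- κ 0 :* Γ) := κ 4 :* (κ 0 :* A) :- κ 0 :* Γ) refl A Γ)
        (solve 0 ((κ 4 :* (κ 1 :* κ 1) :- κ 1 :* κ 3) :* (κ 4 :* (κ 1 :* κ 1) :- κ 1 :* κ 3) := κ 4
            :* (κ 1 :* κ 1) :- κ 1 :* κ 3) refl)
        (solve 0 ((κ 4 :* (κ 1 :* κ 0) :- κ 1 :* κ 0) :* (κ 4 :* (κ 1 :* κ 0) :- κ 1 :* κ 0) := κ 4
            :* (κ 1 :* κ 0) :- κ 1 :* κ 0) refl)
        (solve 0 ((κ 4 :* (κ 1 :* κ 0) :- κ 1 :* con (ℤ.- + 1))
            :* (κ 4 :* (κ 1 :* κ 0) :- κ 1 :* con (ℤ.- + 1)) := κ 4 :* (κ 1 :* κ 0) :- κ 1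
            :* con (ℤ.- + 1)) refl)

      t-supported : Supported t
      t-supported x = trans (sym (*-assoc _ _ _)) (cong (_* A u x) (A-idem v x))

      m-supported : Supported m
      m-supported x = trans (solve 3 (λ a b k → a :* (κ 4 :* (a :* b) :- a :* k) := κ 4
          :* ((a :* a) :* b) :- (a :* a) :* k) refl (a x) (A u x) (Γ u x))
        (cong (λ z → + 4 * (z * A u x) - z * Γ u x) (A-idem v x))

      ε≡2 : ε u ≡ + 2
      ε≡2 = cong e (trans (d-sym u v) d≡2)

      -- The sum of c is -10 · 2 by the eigenvalue, and 2 · 32 - 7 times the sum of m by `c≗`.
      sum-m : sum m ≡ + 12
      sum-m = *-cancelˡ 6 (trans (solve 1
          (λ s → κ 7 :* s := κ 2 :* κ 32 :- (κ 2 :* κ 32 :+ con (ℤ.- + 7) :* s :+ κ 0 :* κ 32)) refl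
          (sum m))
        (trans (cong (λ z → + 2 * + 32 - z)
            (trans (sym (trans (sum-cong-≗ c≗)
            (trans (sum-linear₃ (+ 2) (ℤ.- + 7) (+ 0) a m a)
            (cong (λ z → + 2 * z + (ℤ.- + 7) * sum m + + 0 * z) sum-a))))
            (trans (sum-c u) (cong ((ℤ.- + 10) *_) ε≡2))))
                (solve 0 (κ 2 :* κ 32 :- con (ℤ.- + 10) :* κ 2 := κ 7 :* κ 12) refl)))

      poly-c : ∀ p x → poly p (c u) x ≡ + 2 * (horner (+ 4) p * a x) + (ℤ.- + 7) * poly p m x + + 0
          * (horner (+ 4) p * a x)
      poly-c p x = trans (P.poly-cong p c≗ x) (trans (poly-linear p (+ 2) (ℤ.- + 7) (+ 0) a m a x)
        (cong (λ z → + 2 * z + (ℤ.- + 7) * poly p m x + + 0 * z) (poly-a p x)))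

      -- Vanishing of `E · F` on the neighbours of v: there the term 7 (2 - L) f equals -336 c + 7
      -- q(L) c, so 336 c cancels and q(L) c = -120 a. Substituting c = 2 a - 7 m and q(4) = 192
      -- gives the claim. It means that m has no component in the eigenspace of 2.
      q-m : ∀ x → poly q m x ≡ + 72 * a x
      q-m x = *-cancelˡ 48 (evaluate
          (trans (sym (zeroʳ (a x))) (trans (cong (a x *_) (sym (E·F≡0 u x)))
              (trans (cong (a x *_) (E·F u x))
            (solve 5 (λ a p k s r → a :* (κ 336 :* p :+ κ 1 :* k :+ κ 204 :* s :* r) := κ 336
                :* (a :* p) :+ a :* k :+ κ 204 :* s :* (a :* r)) refl (a x) (E x u) ((E · f u) x)
                (ε u) (E x v)))))
          (cong (a x *_) (radial-sym e x u)) (E-local (f-supported u) x)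
              (trans (sum-f u) (cong (+ 720 *_) ε≡2)) (E-to-centre x) ε≡2
          (trans (sym (linear-polyʳ (f u x) ((L · f u) x)))
              (trans (sym (linear-poly′ x)) (trans
              (sym (P.poly-⊗ (+ 14 ∷ (ℤ.- + 7) ∷ []) -γ (c u) x))
              (trans (P.poly-⊕ ((ℤ.- + 336) ∷ []) (scale (+ 7) q) (c u) x)
              (cong₂ _+_ (trans (cong (λ z → (ℤ.- + 336) * c u x + z) (P.·-0 x)) (+-identityʳ _))
              (P.poly-scale (+ 7) q (c u) x))))))
          (poly-c q x))
        where
        linear-polyʳ : ∀ s l → + 14 * s + (ℤ.- + 7) * l ≡ + 14 * s - + 7 * l
        linear-polyʳ s l = solve 2 (λ s l → κ 14 :* s :+ con (ℤ.- + 7) :* l := κ 14 :* s :- κ 7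
            :* l) refl s l
        linear-poly′ : ∀ x → poly (+ 14 ∷ (ℤ.- + 7) ∷ []) (f u) x ≡ + 14 * f u x + (ℤ.- + 7)
            * (L · f u) x
        linear-poly′ x = cong (λ z → + 14 * f u x + z)
            (trans (·-cong L (λ y → cong (λ z → (ℤ.- + 7) * f u y + z) (P.·-0 y)) x)
            (trans (P.·-+ (ℤ.- + 7) (f u) (λ _ → + 0) x)
            (trans (cong (λ z → (ℤ.- + 7) * (L · f u) x + z) (P.·-0 x)) (+-identityʳ _))))
        evaluate : ∀ {ac ef s b k ε f l b′ qc qm} → + 0 ≡ + 336 * ac + ef + + 204 * ε * k → ac ≡ b′
            → ef ≡ + 14 * f + + 2 * (s * b) - + 7 * l → s ≡ + 720 * + 2 → k ≡ (ℤ.- + 5) * b → ε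
            ≡ + 2 →
          + 14 * f - + 7 * l ≡ (ℤ.- + 336) * b′ + + 7 * qc → qc ≡ + 2 * (+ 192 * b) + (ℤ.- + 7) * qm
              + + 0 * (+ 192 * b) → + 49 * qm ≡ + 49 * (+ 72 * b)
        evaluate {b = b} {f = f} {l} {b′} {qm = qm} h refl refl refl refl refl h′ refl = trans
          (solve 5 (λ b b′ f l q → κ 49 :* q := κ 49 :* (κ 72 :* b)
              :- ((κ 336 :* b′ :+ (κ 14 :* f :+ κ 2 :* ((κ 720 :* κ 2) :* b) :- κ 7 :* l) :+ κ 204
              :* κ 2 :* (con (ℤ.- + 5) :* b))
               :- (κ 14 :* f :- κ 7 :* l) :+ (con (ℤ.- + 336) :* b′ :+ κ 7
                   :* (κ 2 :* (κ 192 :* b) :+ con (ℤ.- + 7) :* q :+ κ 0 :* (κ 192 :* b))))) refl b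
                   b′ f l qm)
          (trans (cong₂ (λ s t → + 49 * (+ 72 * b)
              - (s - t + ((ℤ.- + 336) * b′ + + 7
              * (+ 2 * (+ 192 * b) + (ℤ.- + 7) * qm + + 0 * (+ 192 * b))))) (sym h) h′)
            (solve 2 (λ s k → s :- (κ 0 :- k :+ k) := s) refl (+ 49 * (+ 72 * b)) _))

      -- Vanishing of `E · F` at u itself, after the substitution c = 2 a - 7 m; -72 is -γ(4).
      m-γ-m : ⟨ m , poly -γ m ⟩ ≡ ℤ.- + 432
      m-γ-m = *-cancelˡ 48 (evaluate
        (trans (sym (E·F≡0 u u)) (trans (E·F u u)
            (cong₂ (λ s t → + 336 * s + + 1 * t + + 204 * ε u * ε u) (E-self u)
            (ip-c u (f-supported u))))) ε≡2
        (trans (ip-cong c≗ (poly-c -γ)) (trans (ip-linearˡ (+ 2) (ℤ.- + 7) (+ 0) a m a _)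
          (cong₂ (λ s t → + 2 * s + (ℤ.- + 7) * t + + 0 * s) (expand a) (expand m))))
        (trans (ip-congʳ a (λ x → refl))
            (trans (ip-scaleʳ (ℤ.- + 72) a a)
            (cong ((ℤ.- + 72) *_) (trans (ip-a a-supported) sum-a))))
        (trans (P.poly-adjoint -γ a m) (trans (ip-congˡ m (poly-a -γ))
            (trans (ip-scaleˡ (ℤ.- + 72) a m)
            (cong ((ℤ.- + 72) *_) (trans (ip-a m-supported) sum-m)))))
        (trans (ip-scaleʳ (ℤ.- + 72) m a)
            (cong ((ℤ.- + 72) *_) (trans (ip-comm m a) (trans (ip-a m-supported) sum-m)))))
        where
        expand : ∀ k → ⟨ k , (λ x → + 2 * ((ℤ.- + 72) * a x) + (ℤ.- + 7) * poly -γ m x + + 0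
            * ((ℤ.- + 72) * a x)) ⟩
          ≡ + 2 * ⟨ k , (λ x → (ℤ.- + 72) * a x) ⟩ + (ℤ.- + 7) * ⟨ k , poly -γ m ⟩ + + 0
              * ⟨ k , (λ x → (ℤ.- + 72) * a x) ⟩
        expand k = ip-linearʳ (+ 2) (ℤ.- + 7) (+ 0) (λ x → (ℤ.- + 72) * a x) (poly -γ m)
            (λ x → (ℤ.- + 72) * a x) k
        evaluate : ∀ {ε cf aa am ma mm} → + 0 ≡ + 336 * + 16 + + 1 * cf + + 204 * ε * ε → ε ≡ + 2 →
          cf ≡ + 2 * (+ 2 * aa + (ℤ.- + 7) * am + + 0 * aa) + (ℤ.- + 7)
              * (+ 2 * ma + (ℤ.- + 7) * mm + + 0 * ma) + + 0
              * (+ 2 * aa + (ℤ.- + 7) * am + + 0 * aa) →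
          aa ≡ (ℤ.- + 72) * + 32 → am ≡ (ℤ.- + 72) * + 12 → ma ≡ (ℤ.- + 72) * + 12 → + 49 * mm
              ≡ + 49 * (ℤ.- + 432)
        evaluate {mm = mm} h refl refl refl refl refl = trans
          (solve 1 (λ x → let aa = con (ℤ.- + 72) :* κ 32 ; am = con (ℤ.- + 72) :* κ 12 in
            κ 49 :* x := κ 49 :* con (ℤ.- + 432)
                :+ (κ 336 :* κ 16 :+ κ 1 :* (κ 2 :* (κ 2 :* aa :+ con (ℤ.- + 7) :* am :+ κ 0 :* aa)
              :+ con (ℤ.- + 7) :* (κ 2 :* am :+ con (ℤ.- + 7) :* x :+ κ 0 :* am) :+ κ 0
                  :* (κ 2 :* aa :+ con (ℤ.- + 7) :* am :+ κ 0 :* aa)) :+ κ 204 :* κ 2 :* κ 2)) refl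
                  mm)
          (trans (cong (λ z → + 49 * (ℤ.- + 432) + z) (sym h)) (+-identityʳ _))

      Γ-a : sum (λ x → a x * Γ u x) ≡ + 0
      Γ-a = trans (ip-congʳ a (λ x → trans (radial-sym g u x) (sym (·-δ Γ u x))))
          (trans (radial-eigenfunction tridiagonal-g (δ u) v)
        (trans (cong (+ 8 *_) (trans (·-δ Γ u v) (cong g d≡2))) (zeroʳ (+ 8))))

      -- m - 4 t is minus the row of `Γ` at u restricted to the neighbours of v. That row is
      -- orthogonal to `a`, because `g 2` is 0, and to every σ by `Γ-null`, hence to π(L) δ x = (3 a
      -- - σ) / 2.
      π-m : ∀ x → poly π m x ≡ + 4 * poly π t x
      π-m x with a-values x
      ... | inj₁ h = trans (outside m-supported)
          (sym (trans (cong (+ 4 *_) (outside t-supported)) (zeroʳ (+ 4))))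
        where
        outside : ∀ {f} → Supported f → poly π f x ≡ + 0
        outside {f} s = trans (sym (poly-supported π s x))
            (trans (cong (_* poly π f x) h) (zeroˡ _))
      ... | inj₂ x∈ = trans (at-x m) (trans
          (-≡0⇒≡ (trans (solve 2 (λ i j → i :- κ 4 :* j := κ 1 :* i :+ con (ℤ.- + 4) :* j :+ κ 0
          :* j) refl ⟨ m , k ⟩ ⟨ t , k ⟩)
          (trans (sym (ip-linearˡ (+ 1) (ℤ.- + 4) (+ 0) m t t k))
              (trans (ip-congˡ k (λ y → solve 2
              (λ t g → κ 1 :* (κ 4 :* t :- g) :+ con (ℤ.- + 4) :* t :+ κ 0 :* t := :- g) refl (t y)
              (a y * Γ u y))) orthogonal))))
        (cong (+ 4 *_) (sym (at-x t))))
        where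
        k = poly π (δ x)
        at-x : ∀ f → poly π f x ≡ ⟨ f , k ⟩
        at-x f = trans (sym (ip-δ x (poly π f))) (trans (P.poly-adjoint π (δ x) f) (ip-comm k f))
        orthogonal : ⟨ (λ y → - (a y * Γ u y)) , k ⟩ ≡ + 0
        orthogonal = *-cancelˡ 1 (trans
            (trans (sym (evaluate Γ-a)) (trans (sym (ip-linearʳ (+ 3) (ℤ.- + 2) (+ 0) a k a Γa))
            (trans (sum-cong-≗ (λ y →
            trans (solve 3 (λ b g s → b :* g :* s := g :* (b :* s)) refl (a y) (Γ u y) (σ x∈ y))
                (cong (Γ u y *_) (σ-supported x∈ y))))
          (Γ-null (σ-supported x∈) (σ-eigen x∈) u)))) (sym (zeroʳ (+ 2))))
          where
          Γa : Function
          Γa y = a y * Γ u y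
          evaluate : sum Γa ≡ + 0 → + 3 * ⟨ Γa , a ⟩ + (ℤ.- + 2) * ⟨ Γa , k ⟩ + + 0 * ⟨ Γa , a ⟩
              ≡ + 2 * ⟨ (λ y → - (a y * Γ u y)) , k ⟩
          evaluate h = trans (cong₂ (λ s t → + 3 * s + (ℤ.- + 2) * t + + 0 * s)
              (trans (ip-comm Γa a) (trans (sum-cong-≗
              (λ y → trans (sym (*-assoc _ _ _)) (cong (_* Γ u y) (A-idem v y)))) h)) refl)
            (trans (solve 1 (λ s → κ 3 :* κ 0 :+ con (ℤ.- + 2) :* s :+ κ 0 :* κ 0 := κ 2
                :* (con (ℤ.- + 1) :* s)) refl ⟨ Γa , k ⟩)
            (cong (+ 2 *_) (trans (sym (ip-scaleˡ (ℤ.- + 1) Γa k))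
                (ip-congˡ k (λ y → solve 1 (λ g → con (ℤ.- + 1) :* g := :- g) refl (Γa y))))))

      3∤16 : ∀ y → ¬ + 3 * y ≡ + 16
      3∤16 y h = from-no (3 ∣? 16) (divides ℤ.∣ y ∣
          (trans (cong ℤ.∣_∣ (trans (sym h) (sym (*-homo (+ 3) y))))
          (trans (ℤₚ.abs-* (+ 3) y) (ℕₚ.*-comm 3 ℤ.∣ y ∣))))

      -- With yₖ = ⟨ m , Lᵏ m ⟩ and y₀ = 12, the polynomials π, q and -γ give y₃ - 4 y₁ = 4 · 4 ·
      -- 12, y₃ + 6 y₂ + 8 y₁ = 72 · 12 and y₂ + 8 y₁ = 144. Elimination leaves 36 y₁ = 192,
      -- impossible for an integer y₁.
      π-t-contradiction : ⟨ t , poly π t ⟩ ≡ + 12 → ⊥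
      π-t-contradiction h = 3∤16 (⟨ m , L · m ⟩) (*-cancelˡ 11 (evaluate (sum-cong-≗ m-idem) sum-m
          (trans (sym (P.ip-poly π m m)) (trans (ip-congʳ m π-m)
              (trans (ip-scaleʳ (+ 4) m (poly π t))
              (cong (+ 4 *_) (trans (P.poly-adjoint π m t)
              (trans (ip-congˡ t π-m) (trans (ip-scaleˡ (+ 4) (poly π t) t)
              (cong (+ 4 *_) (trans (ip-comm (poly π t) t) h)))))))))
          (trans (sym (P.ip-poly q m m)) (trans (ip-congʳ m q-m)
              (trans (ip-scaleʳ (+ 72) m a) (cong (+ 72 *_)
              (trans (ip-comm m a) (trans (ip-a m-supported) sum-m))))))
          (trans (sym (P.ip-poly -γ m m)) m-γ-m)))
        where
        evaluate : ∀ {s y₀ y₁ y₂ y₃} → y₀ ≡ s → s ≡ + 12 →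
          + 0 * y₀ + ((ℤ.- + 4) * y₁ + (+ 0 * y₂ + (+ 1 * y₃ + + 0))) ≡ + 4 * (+ 4 * + 12) →
          + 0 * y₀ + (+ 8 * y₁ + (+ 6 * y₂ + (+ 1 * y₃ + + 0))) ≡ + 72 * + 12 →
          (ℤ.- + 24) * y₀ + ((ℤ.- + 8) * y₁ + ((ℤ.- + 1) * y₂ + + 0)) ≡ ℤ.- + 432 → + 12
              * (+ 3 * y₁) ≡ + 12 * + 16
        evaluate {y₁ = y₁} {y₂} {y₃} refl refl h₁ h₂ h₃ = trans
          (solve 3 (λ y₁ y₂ y₃ → κ 12 :* (κ 3 :* y₁)
              := (κ 0 :* κ 12 :+ (con (ℤ.- + 4) :* y₁ :+ (κ 0 :* y₂ :+ (κ 1 :* y₃ :+ κ 0))))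
             :- (κ 0 :* κ 12 :+ (κ 8 :* y₁ :+ (κ 6 :* y₂ :+ (κ 1 :* y₃ :+ κ 0)))) :- κ 6
                 :* (con (ℤ.- + 24) :* κ 12 :+ (con (ℤ.- + 8) :* y₁
                 :+ (con (ℤ.- + 1) :* y₂ :+ κ 0))) :- κ 1728) refl y₁ y₂ y₃)
          (trans (cong₂ (λ s k → s - k - + 1728) (cong₂ _-_ h₁ h₂) (cong (+ 6 *_) h₃))
            (solve 0 (κ 4 :* (κ 4 :* κ 12) :- κ 72 :* κ 12 :- κ 6 :* con (ℤ.- + 432) :- κ 1728
                := κ 12 :* κ 16) refl))

      t-values : ∀ x → t x ≡ + 0 ⊎ (Adj v x × Adj u x × t x ≡ + 1)
      t-values x with A-values v x | A-values u x
      ... | inj₁ h | _ = inj₁ (trans (cong (_* A u x) h) (zeroˡ _))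
      ... | inj₂ _ | inj₁ h = inj₁ (trans (cong (a x *_) h) (zeroʳ _))
      ... | inj₂ (f , h) | inj₂ (f′ , h′) = inj₂
          (f , f′ , trans (cong₂ _*_ h h′) (*-identityˡ (+ 1)))

      sum-t : sum t ≡ + 3
      sum-t = trans (sum-cong-≗ (λ x → trans (*-comm (a x) (A u x))
          (cong (A u x *_) (𝟙-cong (adj? v x) (d v x ℕ.≟ 1) Adj⇒d≡1 d≡1⇒Adj))))
        (trans (sum-neighbours (unit 1) v u)
            (trans (cong (tridiagonal (unit 1)) d≡2)
            (solve 0 (κ 3 :* κ 1 :+ κ 20 :* κ 0 :+ κ 9 :* κ 0 := κ 3) refl)))

      module _ {x y : V} (xy : LocallyAdjacent x y) (ux : Adj u x) (uy : Adj u y) where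

        private
          rest : Function
          rest = linear₃ (+ 1) (ℤ.- + 1) (ℤ.- + 1) t (δ x) (δ y)

          t-on : ∀ {w} → Adj v w → Adj u w → t w ≡ + 1
          t-on {w} f f′ = trans (cong₂ _*_ (𝟙-yes (adj? v w) f) (𝟙-yes (adj? u w) f′))
              (*-identityˡ (+ 1))

          tx : t x ≡ + 1
          tx = t-on (proj₁ (local-members xy)) ux

          ty : t y ≡ + 1
          ty = t-on (proj₂ (proj₂ (local-members xy))) uy

          rest-values : ∀ w → rest w ≡ + 0 ⊎ (Adj v w × rest w ≡ + 1 × δ x w ≡ + 0 × δ y w ≡ + 0)
          rest-values w with x ≟ w | y ≟ w
          ... | yes refl | yes r = ⊥-elim (local-≢ xy (sym r))
          ... | yes refl | no _ = inj₁ (trans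
              (cong (λ z → + 1 * z + (ℤ.- + 1) * + 1 + (ℤ.- + 1) * + 0) tx)
              (solve 0 (κ 1 :* κ 1 :+ con (ℤ.- + 1) :* κ 1 :+ con (ℤ.- + 1) :* κ 0 := κ 0) refl))
          ... | no _ | yes refl = inj₁ (trans
              (cong (λ z → + 1 * z + (ℤ.- + 1) * + 0 + (ℤ.- + 1) * + 1) ty)
              (solve 0 (κ 1 :* κ 1 :+ con (ℤ.- + 1) :* κ 0 :+ con (ℤ.- + 1) :* κ 1 := κ 0) refl))
          ... | no _ | no _ with t-values w
          ... | inj₁ h = inj₁ (trans (cong (λ z → + 1 * z + (ℤ.- + 1) * + 0 + (ℤ.- + 1) * + 0) h)
              (solve 0 (κ 1 :* κ 0 :+ con (ℤ.- + 1) :* κ 0 :+ con (ℤ.- + 1) :* κ 0 := κ 0) refl))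
          ... | inj₂ (f , _ , h) = inj₂ (f , trans
              (cong (λ z → + 1 * z + (ℤ.- + 1) * + 0 + (ℤ.- + 1) * + 0) h)
              (solve 0 (κ 1 :* κ 1 :+ con (ℤ.- + 1) :* κ 0 :+ con (ℤ.- + 1) :* κ 0 := κ 1) refl) ,
              refl , refl)

          sum-rest : sum rest ≡ + 1
          sum-rest = trans (sum-linear₃ (+ 1) (ℤ.- + 1) (ℤ.- + 1) t (δ x) (δ y))
              (evaluate sum-t (sum-δ-1 x) (sum-δ-1 y))
            where
            evaluate : ∀ {i j k} → i ≡ + 3 → j ≡ + 1 → k ≡ + 1 → + 1 * i + (ℤ.- + 1) * j + (ℤ.- + 1)
                * k ≡ + 1
            evaluate refl refl refl = solve 0
                (κ 1 :* κ 3 :+ con (ℤ.- + 1) :* κ 1 :+ con (ℤ.- + 1) :* κ 1 := κ 1) refl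

          -- `rest` takes the values 0 and 1 and has sum 1. For a z with value 1 the difference
          -- `rest` - δ z is nonnegative of sum 0.
          third : ∃ λ z → Adj v z × (∀ w → rest w ≡ δ z w)
          third with sum-nonzero {f = rest} (λ h → 1≢0 (trans (sym sum-rest) h))
            where
            1≢0 : ¬ + 1 ≡ + 0
            1≢0 ()
          ... | z , z≢0 with rest-values z
          ... | inj₁ h = ⊥-elim (z≢0 h)
          ... | inj₂ (f , h , _) = z , f , λ w → -≡0⇒≡ (sum-zero-nonneg nonneg total w)
            where
            nonneg : ∀ w → + 0 ≤ rest w - δ z w
            nonneg w with z ≟ w
            ... | yes refl = subst (+ 0 ≤_)
                (trans (solve 0 (κ 0 := κ 1 :- κ 1) refl) (cong (_- + 1) (sym h))) (+≤+ z≤n)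
            ... | no _ with rest-values w
            ... | inj₁ k = subst (+ 0 ≤_) (trans (solve 0 (κ 0 := κ 0 :- κ 0) refl)
                (cong (_- + 0) (sym k))) (+≤+ z≤n)
            ... | inj₂ (_ , k , _) = subst (+ 0 ≤_)
                (trans (solve 0 (κ 1 := κ 1 :- κ 0) refl) (cong (_- + 0) (sym k))) (+≤+ z≤n)
            total : sum (λ w → rest w - δ z w) ≡ + 0
            total = trans (sum-cong-≗ (λ w → solve 2
                (λ r d → r :- d := κ 1 :* r :+ con (ℤ.- + 1) :* d :+ κ 0 :* d) refl (rest w)
                (δ z w)))
              (trans (sum-linear₃ (+ 1) (ℤ.- + 1) (+ 0) rest (δ z) (δ z))
                  (evaluate sum-rest (sum-δ-1 z)))
              where
              evaluate : ∀ {i j} → i ≡ + 1 → j ≡ + 1 → + 1 * i + (ℤ.- + 1) * j + + 0 * j ≡ + 0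
              evaluate refl refl = solve 0 (κ 1 :* κ 1 :+ con (ℤ.- + 1) :* κ 1 :+ κ 0 :* κ 1 := κ 0)
                  refl

        -- Every neighbour w of v satisfies π(L) δ x + π(L) δ y = 3 at w, because x and y are
        -- adjacent; over the three points of t this contributes 9. The row of the third vertex z
        -- contributes 3 at x and y together, and 0 at z.
        π-t : ⟨ t , poly π t ⟩ ≡ + 12
        π-t with third
        ... | z , f , rest≗ = evaluate
              (trans (sum-cong-≗ (λ w → cong (t w *_) (expand w)))
                  (trans (ip-linearʳ (+ 1) (+ 1) (+ 1) (poly π (δ x)) (poly π (δ y)) (poly π (δ z))
                  t) (cong (λ s → s + + 1 * ⟨ t , poly π (δ z) ⟩) xy-part)))
              (trans (ip-comm t _) (trans (ip-congʳ (poly π (δ z)) t≗)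
                  (ip-linearʳ (+ 1) (+ 1) (+ 1) (δ x) (δ y) (δ z) (poly π (δ z)))))
              (ip-δʳ _ x) (ip-δʳ _ y) (ip-δʳ _ z) (π-alternating z∈ xy) (π-root z∈)
          where
          z∈ : a z ≡ + 1
          z∈ = 𝟙-yes (adj? v z) f
          t≗ : ∀ w → t w ≡ linear₃ (+ 1) (+ 1) (+ 1) (δ x) (δ y) (δ z) w
          t≗ w = trans (solve 3 (λ t p q → t := κ 1 :* p :+ κ 1 :* q :+ κ 1
              :* (κ 1 :* t :+ con (ℤ.- + 1) :* p :+ con (ℤ.- + 1) :* q)) refl (t w) (δ x w) (δ y w))
            (cong (λ s → + 1 * δ x w + + 1 * δ y w + + 1 * s) (rest≗ w))
          expand : ∀ w → poly π t w ≡ linear₃ (+ 1) (+ 1) (+ 1) (poly π (δ x)) (poly π (δ y))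
              (poly π (δ z)) w
          expand w = trans (P.poly-cong π t≗ w)
              (poly-linear π (+ 1) (+ 1) (+ 1) (δ x) (δ y) (δ z) w)
          xy-part : + 1 * ⟨ t , poly π (δ x) ⟩ + + 1 * ⟨ t , poly π (δ y) ⟩ ≡ + 9
          xy-part = trans (solve 2 (λ p q → κ 1 :* p :+ κ 1 :* q := κ 1 :* p :+ κ 1 :* q :+ κ 0
              :* q) refl ⟨ t , poly π (δ x) ⟩ ⟨ t , poly π (δ y) ⟩)
            (trans (sym (ip-linearʳ (+ 1) (+ 1) (+ 0) (poly π (δ x)) (poly π (δ y)) (poly π (δ y))
                t))
            (trans (sum-cong-≗ term) (trans (sym (*-distribʳ-sum (+ 3) t))
                (trans (cong (_* + 3) sum-t) (solve 0 (κ 3 :* κ 3 := κ 9) refl)))))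
            where
            term : ∀ w → t w * (+ 1 * poly π (δ x) w + + 1 * poly π (δ y) w + + 0 * poly π (δ y) w)
                ≡ t w * + 3
            term w with t-values w
            ... | inj₁ h = trans (cong (_* (+ 1 * poly π (δ x) w + + 1 * poly π (δ y) w + + 0 * poly
                π (δ y) w)) h) (trans (zeroˡ _) (sym (trans (cong (_* + 3) h) (zeroˡ _))))
            ... | inj₂ (k , _) = cong (t w *_)
                (trans (solve 2 (λ p q → κ 1 :* p :+ κ 1 :* q :+ κ 0 :* q := p :+ q) refl
                (poly π (δ x) w) (poly π (δ y) w))
              (trans (cong₂ _+_ (poly-δ-sym π x w) (poly-δ-sym π y w))
                  (π-alternating (𝟙-yes (adj? v w) k) xy)))
          evaluate : ∀ {i j k₁ k₂ k₃ p₁ p₂ p₃} → i ≡ + 9 + + 1 * j → j ≡ + 1 * k₁ + + 1 * k₂ + + 1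
              * k₃ → k₁ ≡ p₁ → k₂ ≡ p₂ → k₃ ≡ p₃ → p₁ + p₂ ≡ + 3 → p₃ ≡ + 0 → i ≡ + 12
          evaluate {p₁ = p₁} {p₂} refl refl refl refl refl h refl = trans
              (solve 2 (λ p q → κ 9 :+ κ 1 :* (κ 1 :* p :+ κ 1 :* q :+ κ 1 :* κ 0) := κ 9
              :+ (p :+ q)) refl p₁ p₂)
            (trans (cong (λ s → + 9 + s) h) (solve 0 (κ 9 :+ κ 3 := κ 12) refl))

        impossible : ⊥
        impossible = π-t-contradiction π-t

    -- Choice of the vertex u

    common-neighbours : ∀ {x y} → Adj x y → sum (λ w → A x w * A y w) ≡ + 4
    common-neighbours {x} {y} f = trans
        (sum-cong-≗ (λ w → cong (A x w *_) (𝟙-cong (adj? y w) (d y w ℕ.≟ 1) Adj⇒d≡1 d≡1⇒Adj)))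
      (trans (sum-neighbours (unit 1) y x)
          (trans (cong (tridiagonal (unit 1)) (Adj⇒d≡1 (Adj-sym f)))
          (solve 0 (κ 0 :+ κ 4 :* κ 1 :+ κ 27 :* κ 0 := κ 4) refl)))

    -- Adjacent vertices have a₁ = 4 common neighbours, and v accounts for only one of them.
    another-common-neighbour : ∀ {x y} → LocallyAdjacent x y → ∃ λ u → ¬ v ≡ u × Adj x u × Adj y u
    another-common-neighbour {x} {y} xy with sum-nonzero {f = λ w → A x w * A y w - δ v w}
        (λ h → 3≢0 (trans (sym total) h))
      where
      3≢0 : ¬ + 3 ≡ + 0
      3≢0 ()
      total : sum (λ w → A x w * A y w - δ v w) ≡ + 3
      total = trans (sum-cong-≗ (λ w → solve 2
          (λ p q → p :- q := κ 1 :* p :+ con (ℤ.- + 1) :* (q :* κ 1) :+ κ 0 :* p) refl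
          (A x w * A y w) (δ v w)))
        (trans (sum-linear₃ (+ 1) (ℤ.- + 1) (+ 0) (λ w → A x w * A y w) (λ w → δ v w * + 1)
            (λ w → A x w * A y w))
        (trans (cong₂ (λ s t → + 1 * s + (ℤ.- + 1) * t + + 0 * s)
            (common-neighbours (proj₁ (proj₂ (local-members xy)))) (sum-δ v (λ _ → + 1)))
          (solve 0 (κ 1 :* κ 4 :+ con (ℤ.- + 1) :* κ 1 :+ κ 0 :* κ 4 := κ 3) refl)))
    ... | u , h with v ≟ u
    ... | yes refl = ⊥-elim (h (trans
        (cong₂ (λ s t → s * t - + 1) (𝟙-yes (adj? x v) (Adj-sym (proj₁ (local-members xy))))
        (𝟙-yes (adj? y v) (Adj-sym (proj₂ (proj₂ (local-members xy))))))
        (solve 0 (κ 1 :* κ 1 :- κ 1 := κ 0) refl)))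
    ... | no v≢u with A-values x u | A-values y u
    ... | inj₂ (f , _) | inj₂ (f′ , _) = u , v≢u , f , f′
    ... | inj₁ k | _ = ⊥-elim (h (trans (cong (λ s → s * A y u - + 0) k)
        (solve 1 (λ s → κ 0 :* s :- κ 0 := κ 0) refl (A y u))))
    ... | inj₂ _ | inj₁ k = ⊥-elim (h
        (trans (cong (λ s → A x u * s - + 0) k)
        (solve 1 (λ s → s :* κ 0 :- κ 0 := κ 0) refl (A x u))))

    local-edge : ∃ λ x → ∃ λ y → LocallyAdjacent x y
    local-edge with sum-nonzero {f = a} (λ h → 32≢0 (trans (sym sum-a) h))
      where
      32≢0 : ¬ + 32 ≡ + 0
      32≢0 ()
    ... | x , x≢0 with a-values x
    ... | inj₁ h = ⊥-elim (x≢0 h)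
    ... | inj₂ h with sum-nonzero {f = λ y → L x y * a y}
        (λ k → 4≢0 (trans (sym (trans (L-a x) (cong (+ 4 *_) h))) k))
      where
      4≢0 : ¬ + 4 * + 1 ≡ + 0
      4≢0 k with () ← trans (sym (trans (*-comm (+ 4) (+ 1)) (*-identityˡ (+ 4)))) k
    ... | y , y≢0 = x , y , local-adj (λ k → y≢0 (trans (cong (_* a y) k) (zeroˡ _)))

    no-neighbourhood : ⊥
    no-neighbourhood with local-edge
    ... | x , y , xy with another-common-neighbour xy | local-members xy
    ... | u , v≢u , xu , yu | vx , x~y , vy = impossible (distance-2 (d v u) refl) xy (Adj-sym xu)
        (Adj-sym yu)
      where
      distance-2 : ∀ j → d v u ≡ j → d v u ≡ 2
      distance-2 0 h = ⊥-elim (v≢u (d≡0⇒≡ h))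
      -- If u were adjacent to v, then x, y and u would form a triangle in the local graph.
      distance-2 1 h = ⊥-elim (no-triangle xy (adjacent vy yu vu) (adjacent vu (Adj-sym xu) vx))
        where
        vu = d≡1⇒Adj h
        adjacent : ∀ {p q} → Adj v p → Adj p q → Adj v q → LocallyAdjacent p q
        adjacent {p} {q} f g f′ = trans
            (cong₂ _*_ (cong₂ _*_ (𝟙-yes (adj? v p) f) (𝟙-yes (adj? p q) g)) (𝟙-yes (adj? v q) f′))
            (solve 0 (κ 1 :* κ 1 :* κ 1 := κ 1) refl)
      distance-2 2 h = h
      distance-2 (suc (suc (suc j))) h with s≤s (s≤s ()) ← subst (ℕ._≤ 2) h
          (d-≤-walk (cons vx (cons xu nil)))

theorem4p8 : (n : ℕ) (G : SimpleGraph n) →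
    ¬ IsDistanceRegular G 4 (32 ∷ 27 ∷ 9 ∷ 1 ∷ []) (1 ∷ 3 ∷ 27 ∷ 32 ∷ [])
-- The base vertex is supplied by the pair at which the diameter is attained.
theorem4p8 n G dr = DistanceRegular.Neighbourhood.no-neighbourhood n G dr
    (proj₁ (proj₂ (proj₂ (proj₁ dr))))
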